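{- Let $k$ be a fixed positive integer. For each positive integer $n$, let $b_k(n)$ denote the number of $2k \times 2n$ matrices with entries in $\{0,1\}$ such that every row contains exactly $n$ ones (and hence exactly $n$ zeroes) and every column contains exactly $k$ ones (and hence exactly $k$ zeroes). Then the sequence $\{b_k(n)\}_{n=1}^{\infty}$ is holonomic (P-recursive): there exist a positive integer $L$ and polynomials $p_0(n), \dots, p_L(n)$ in $n$, with $p_L(n) \neq 0$, such that $$\sum_{i=0}^{L} p_i(n)\, b_k(n+i) = 0$$ for all positive integers $n$.
   Context: A $0$-$1$ matrix is called balanced if every row and every column contains as many zeroes as ones. -}

module Defs where

open import Data.Nat using (ℕ; zero; suc; _≡ᵇ_) renaming (_+_ to _+ℕ_; _*_ to _*ℕ_)
open import Data.Bool using (Bool; true; false; _∧_; T)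
open import Data.List using (List; []; _∷_; concatMap; map; filterᵇ; length)
open import Data.Vec using (Vec; []; _∷_; lookup; foldr)
import Data.Vec as V
open import Data.Fin using (Fin)
open import Data.Integer using (+_)
open import Data.Rational using (ℚ; 0ℚ; _+_; _*_; _/_)
open import Data.Product using (Σ; _×_)
open import Data.List.Relation.Unary.Any using (Any)
open import Relation.Binary.PropositionalEquality using (_≢_)

allVecs : {A : Set} → List A → (n : ℕ) → List (Vec A n)
allVecs xs zero = [] ∷ []
allVecs xs (suc n) = concatMap (λ x → map (x ∷_) (allVecs xs n)) xs

Matrix01 : ℕ → ℕ → Set
Matrix01 m c = Vec (Vec Bool c) m

allMatrices : (m c : ℕ) → List (Matrix01 m c)
allMatrices m c = allVecs (allVecs (false ∷ true ∷ []) c) m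

ones : {n : ℕ} → Vec Bool n → ℕ
ones = foldr _ (λ b acc → (if b then 1 else 0) +ℕ acc) 0
  where open import Data.Bool using (if_then_else_)

allᵇ : {n : ℕ} → Vec Bool n → Bool
allᵇ = foldr _ _∧_ true

rowColSumsᵇ : {m c : ℕ} → ℕ → ℕ → Matrix01 m c → Bool
rowColSumsᵇ {m} {c} r s M =
  allᵇ (V.map (λ row → ones row ≡ᵇ r) M) ∧
  allᵇ (V.tabulate {n = c} (λ j → ones (V.map (λ row → lookup row j) M) ≡ᵇ s))

b : ℕ → ℕ → ℕ
b k n = length (filterᵇ (rowColSumsᵇ n k) (allMatrices (2 *ℕ k) (2 *ℕ n)))

-- polynomials in one variable with rational coefficients,
-- coefficient list [c₀, c₁, …] represents c₀ + c₁ x + c₂ x² + …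
Poly : Set
Poly = List ℚ

ℕ→ℚ : ℕ → ℚ
ℕ→ℚ n = (+ n) / 1

eval : Poly → ℕ → ℚ
eval [] x = 0ℚ
eval (c ∷ cs) x = c + ℕ→ℚ x * eval cs x

NonZeroPoly : Poly → Set
NonZeroPoly p = Any (λ c → c ≢ 0ℚ) p

sumFin : (L : ℕ) → (Fin (suc L) → ℚ) → ℚ
sumFin L f = foldr _ _+_ 0ℚ (V.tabulate f)

{-# OPTIONS --safe #-}
module Submission where

-- Reading matrices by columns, b_k(n) is the coefficient of x_1^n ⋯ x_{2k}^n in e_k(x_1, …, x_{2k})^(2n).
-- Let P = e_k and d = 2k.  The functions n^c ∂^a x^(-n-j) P^(2n+2j) with a in [0, q)^d, j in [D, D + q) and
-- c < D = d q all lie in the span of n^c′ x^(-n-σ) P^(2n), with c′ < 2D and σ in a box of side O(q).  For large q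
-- they outnumber the spanning functions, which forces a relation Σ_a R_a ∂^a = 0, where each R_a is an operator
-- in n and the shift of n.  For the lexicographically first a with R_a ≠ 0 there is a coefficient at which all
-- later ∂^a′ vanish; extracting it leaves the recurrence R_a b_k = 0.

-- The count succeeds because the spanning functions lack the parameter j. Both families have d
-- parameters of size O(q) and a degree in n of size O(D), but going from j to j + 1 only multiplies
-- by P^2 / (x_1 ⋯ x_d), which is multiplied out and merely widens the box of σ. Derivatives are
-- cheap as well: each lowers the exponent of P by one, and the factors it brings down are linear in
-- n, so it raises the degree in n by at most one. As |a| ≤ D, the degree range D of c at most
-- doubles, and j ≥ D keeps the exponent of P at least 2n. Powers of n and shifts belong to the
-- functions, so the relation has integer coefficients, and linear algebra over the noncommutative
-- ring of operators is avoided. The danger is that R_0 = 0, so that the constant term alone yields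
-- nothing. Therefore the coefficients at all x^(-e) are kept: at e = a, ∂^a gives the constant term
-- times a_1! ⋯ a_d!, while a lexicographically later a′ exceeds a at the first place where they
-- differ, and its falling factorial contains 0.

open import Data.Bool.Base using (Bool)
open import Data.Integer.Base using (ℤ)
open import Data.Nat.Base using (ℕ)
open import Data.Product using (_×_)
open import Data.Vec.Base using (Vec)

-- Finite sums of integers over lists.

module Sums where

  open import Data.Integer.Base using (ℤ; 0ℤ; _+_; _*_)
  open import Data.Integer.Properties using (+-identityˡ; +-assoc; *-zeroʳ; *-distribˡ-+)
  open import Data.Integer.Tactic.RingSolver using (solve-∀)
  open import Data.List.Base using (List; []; _∷_; _++_; map; concatMap)
  open import Relation.Binary.PropositionalEquality

  private variable
    A B : Set

  ∑ : List A → (A → ℤ) → ℤ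
  ∑ []       f = 0ℤ
  ∑ (x ∷ xs) f = f x + ∑ xs f

  ∑-cong : ∀ (xs : List A) {f g} → (∀ x → f x ≡ g x) → ∑ xs f ≡ ∑ xs g
  ∑-cong []       f≗g = refl
  ∑-cong (x ∷ xs) f≗g = cong₂ _+_ (f≗g x) (∑-cong xs f≗g)

  ∑-zero : ∀ (xs : List A) → ∑ xs (λ _ → 0ℤ) ≡ 0ℤ
  ∑-zero []       = refl
  ∑-zero (x ∷ xs) = trans (+-identityˡ _) (∑-zero xs)

  ∑-+ : ∀ (xs : List A) f g → ∑ xs (λ x → f x + g x) ≡ ∑ xs f + ∑ xs g
  ∑-+ []       f g = refl
  ∑-+ (x ∷ xs) f g = trans (cong (f x + g x +_) (∑-+ xs f g)) (lemma (f x) (g x) (∑ xs f) (∑ xs g))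
    where
    lemma : ∀ a b c d → a + b + (c + d) ≡ a + c + (b + d)
    lemma = solve-∀

  ∑-*ˡ : ∀ (xs : List A) c f → ∑ xs (λ x → c * f x) ≡ c * ∑ xs f
  ∑-*ˡ []       c f = sym (*-zeroʳ c)
  ∑-*ˡ (x ∷ xs) c f = trans (cong (c * f x +_) (∑-*ˡ xs c f)) (sym (*-distribˡ-+ c _ _))

  ∑-swap : ∀ (xs : List A) (ys : List B) (f : A → B → ℤ) →
           ∑ xs (λ x → ∑ ys (f x)) ≡ ∑ ys (λ y → ∑ xs (λ x → f x y))
  ∑-swap []       ys f = sym (∑-zero ys)
  ∑-swap (x ∷ xs) ys f = trans (cong (∑ ys (f x) +_) (∑-swap xs ys f)) (sym (∑-+ ys _ _))

  ∑-++ : ∀ (xs ys : List A) f → ∑ (xs ++ ys) f ≡ ∑ xs f + ∑ ys f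
  ∑-++ []       ys f = sym (+-identityˡ _)
  ∑-++ (x ∷ xs) ys f = trans (cong (f x +_) (∑-++ xs ys f)) (sym (+-assoc (f x) _ _))

  ∑-map : ∀ (h : A → B) xs f → ∑ (map h xs) f ≡ ∑ xs (λ x → f (h x))
  ∑-map h []       f = refl
  ∑-map h (x ∷ xs) f = cong (f (h x) +_) (∑-map h xs f)

  ∑-concatMap : ∀ (h : A → List B) xs f → ∑ (concatMap h xs) f ≡ ∑ xs (λ x → ∑ (h x) f)
  ∑-concatMap h []       f = refl
  ∑-concatMap h (x ∷ xs) f =
    trans (∑-++ (h x) (concatMap h xs) f) (cong (∑ (h x) f +_) (∑-concatMap h xs f))

-- Fraction-free linear algebra for integer-valued functions.

module LinearAlgebra (X : Set) where

  open import Data.Empty using (⊥; ⊥-elim)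
  open import Data.Integer.Base using (ℤ; 0ℤ; 1ℤ; _+_; _-_; _*_; -_)
  open import Data.Integer.Properties using (_≟_; *-zeroˡ; *-zeroʳ; +-identityˡ; +-identityʳ; i*j≡0⇒i≡0∨j≡0)
  open import Data.Integer.Tactic.RingSolver using (solve-∀)
  open import Data.List.Base using (List; []; _∷_; _++_; map; concatMap; length)
  open import Data.List.Membership.Propositional using (_∈_)
  open import Data.List.Relation.Unary.All as All using (All; []; _∷_)
  open import Data.List.Relation.Unary.All.Properties using (++⁻)
  open import Data.List.Relation.Unary.AllPairs using (AllPairs; []; _∷_)
  open import Data.List.Relation.Unary.Any using (here; there)
  open import Data.Nat.Base as ℕ using (suc; s≤s⁻¹)
  import Data.Nat.Properties as ℕ
  open import Data.Product using (Σ; _×_; _,_; proj₁; proj₂)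
  open import Data.Sum.Base using (_⊎_; inj₁; inj₂)
  open import Relation.Binary.PropositionalEquality
  open import Relation.Nullary using (Dec; yes; no; ¬_)
  open import Relation.Nullary.Decidable using (_⊎-dec_; ¬?)
  open Sums

  F : Set
  F = X → ℤ

  private variable
    A : Set

  Coeffs : List A → Set
  Coeffs = All (λ _ → ℤ)

  NonZero : {xs : List A} → Coeffs xs → Set
  NonZero []       = ⊥
  NonZero (r ∷ rs) = r ≢ 0ℤ ⊎ NonZero rs

  nonZero? : {xs : List A} (rs : Coeffs xs) → Dec (NonZero rs)
  nonZero? []       = no λ ()
  nonZero? (r ∷ rs) = ¬? (r ≟ 0ℤ) ⊎-dec nonZero? rs

  dot : {fs : List F} → Coeffs fs → F
  dot {[]}     []       x = 0ℤ
  dot {f ∷ fs} (r ∷ rs) x = r * f x + dot rs x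

  dot-zero : {fs : List F} (rs : Coeffs fs) → ¬ NonZero rs → ∀ x → dot rs x ≡ 0ℤ
  dot-zero []       _   x = refl
  dot-zero {f ∷ fs} (r ∷ rs) ¬nz x with r ≟ 0ℤ
  ... | yes refl = trans (+-identityˡ _) (dot-zero rs (λ nz → ¬nz (inj₂ nz)) x)
  ... | no  r≢0  = ⊥-elim (¬nz (inj₁ r≢0))

  dot-vanish : {fs : List F} (rs : Coeffs fs) {x : X} → All (λ f → f x ≡ 0ℤ) fs → dot rs x ≡ 0ℤ
  dot-vanish []       []       = refl
  dot-vanish (r ∷ rs) {x} (p ∷ ps) rewrite p | dot-vanish rs {x} ps = trans (+-identityʳ _) (*-zeroʳ r)

  dot-++ : ∀ (fs : List F) {gs} (rs : Coeffs (fs ++ gs)) x →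
           dot rs x ≡ dot (proj₁ (++⁻ fs rs)) x + dot (proj₂ (++⁻ fs rs)) x
  dot-++ []       rs       x = sym (+-identityˡ _)
  dot-++ (f ∷ fs) (r ∷ rs) x =
    trans (cong (r * f x +_) (dot-++ fs rs x)) (lemma (r * f x) _ _)
    where
    lemma : ∀ a b c → a + (b + c) ≡ a + b + c
    lemma = solve-∀

  nonZero-++⁻ : ∀ (xs : List A) {ys} (rs : Coeffs (xs ++ ys)) → NonZero rs →
                NonZero (proj₁ (++⁻ xs rs)) ⊎ NonZero (proj₂ (++⁻ xs rs))
  nonZero-++⁻ []       rs       nz        = inj₂ nz
  nonZero-++⁻ (x ∷ xs) (r ∷ rs) (inj₁ nz) = inj₁ (inj₁ nz)
  nonZero-++⁻ (x ∷ xs) (r ∷ rs) (inj₂ nz) with nonZero-++⁻ xs rs nz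
  ... | inj₁ p = inj₁ (inj₂ p)
  ... | inj₂ p = inj₂ p

  record Dependent (fs : List F) : Set where
    constructor relation
    field
      coeffs  : Coeffs fs
      nonZero : NonZero coeffs
      dot≡0   : ∀ x → dot coeffs x ≡ 0ℤ

  -- Membership by successive subtraction, so that eliminating the first generator is a case
  -- distinction on one integer.
  InSpan : List F → F → Set
  InSpan []       f = ∀ x → f x ≡ 0ℤ
  InSpan (g ∷ gs) f = Σ ℤ λ c → InSpan gs (λ x → f x - c * g x)

  inSpan-ext : ∀ gs {f f′ : F} → (∀ x → f x ≡ f′ x) → InSpan gs f → InSpan gs f′
  inSpan-ext []       f≗f′ p       x = trans (sym (f≗f′ x)) (p x)
  inSpan-ext (g ∷ gs) f≗f′ (c , p)   = c , inSpan-ext gs (λ x → cong (_- c * g x) (f≗f′ x)) p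

  inSpan-0 : ∀ gs → InSpan gs (λ _ → 0ℤ)
  inSpan-0 []       x = refl
  inSpan-0 (g ∷ gs)   = 0ℤ , inSpan-ext gs (λ x → refl) (inSpan-0 gs)

  inSpan-combine : ∀ gs a b {f f′ : F} → InSpan gs f → InSpan gs f′ →
                   InSpan gs (λ x → a * f x + b * f′ x)
  inSpan-combine []       a b p q x rewrite p x | q x = cong₂ _+_ (*-zeroʳ a) (*-zeroʳ b)
  inSpan-combine (g ∷ gs) a b {f} {f′} (c , p) (c′ , q) =
    a * c + b * c′ ,
    inSpan-ext gs (λ x → lemma a b c c′ (f x) (f′ x) (g x)) (inSpan-combine gs a b p q)
    where
    lemma : ∀ a b c c′ f f′ g → a * (f - c * g) + b * (f′ - c′ * g) ≡ a * f + b * f′ - (a * c + b * c′) * g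
    lemma = solve-∀

  inSpan-∈ : ∀ {gs g} → g ∈ gs → InSpan gs g
  inSpan-∈ {g ∷ gs} (here refl) = 1ℤ , inSpan-ext gs (λ x → lemma (g x)) (inSpan-0 gs)
    where
    lemma : ∀ a → 0ℤ ≡ a - 1ℤ * a
    lemma = solve-∀
  inSpan-∈ {g ∷ gs} {f} (there p) = 0ℤ , inSpan-ext gs (λ x → lemma (f x) (g x)) (inSpan-∈ p)
    where
    lemma : ∀ a b → a ≡ a - 0ℤ * b
    lemma = solve-∀

  -- The scale is what lets several eliminations be composed without division.
  record Elimination (gs fs : List F) : Set where
    field
      rest      : List F
      length≡   : length fs ≡ suc (length rest)
      rest∈     : All (InSpan gs) rest
      scale     : ℤ
      scale≢0   : scale ≢ 0ℤ
      lift      : Coeffs rest → Coeffs fs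
      lift-nz   : ∀ {rs} → NonZero rs → NonZero (lift rs)
      lift-dot  : ∀ rs x → dot (lift rs) x ≡ scale * dot rs x

  *-nonZero : ∀ {i j} → i ≢ 0ℤ → j ≢ 0ℤ → i * j ≢ 0ℤ
  *-nonZero {i} i≢0 j≢0 ij≡0 with i*j≡0⇒i≡0∨j≡0 i ij≡0
  ... | inj₁ p = i≢0 p
  ... | inj₂ p = j≢0 p

  module _ {g : F} {gs : List F} (f : F) {c : ℤ} (c≢0 : c ≢ 0ℤ) (p : InSpan gs (λ x → f x - c * g x)) where

    -- Cross-multiplication with the pivot `f`: since f - c g and h - d g lie in the span of `gs`,
    -- so does c h - d f, without division.
    reduced : {fs : List F} → All (InSpan (g ∷ gs)) fs → List F
    reduced []                      = []
    reduced {h ∷ _} ((d , _) ∷ fs∈) = (λ x → c * h x + (- d) * f x) ∷ reduced fs∈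

    length-reduced : ∀ {fs} (fs∈ : All (InSpan (g ∷ gs)) fs) → length fs ≡ length (reduced fs∈)
    length-reduced []        = refl
    length-reduced (_ ∷ fs∈) = cong suc (length-reduced fs∈)

    reduced∈ : ∀ {fs} (fs∈ : All (InSpan (g ∷ gs)) fs) → All (InSpan gs) (reduced fs∈)
    reduced∈ []                      = []
    reduced∈ {h ∷ _} ((d , q) ∷ fs∈) =
      inSpan-ext gs (λ x → lemma c d (f x) (g x) (h x)) (inSpan-combine gs c (- d) q p) ∷ reduced∈ fs∈
      where
      lemma : ∀ c d f g h → c * (h - d * g) + (- d) * (f - c * g) ≡ c * h + (- d) * f
      lemma = solve-∀

    -- The first component is the coefficient that the pivot `f` collects when the combinations c h
    -- - d f are expanded; the others become c r, nonzero wherever r is.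
    unreduce : ∀ {fs} (fs∈ : All (InSpan (g ∷ gs)) fs) → Coeffs (reduced fs∈) → ℤ × Coeffs fs
    unreduce []              []       = 0ℤ , []
    unreduce ((d , _) ∷ fs∈) (r ∷ rs) with unreduce fs∈ rs
    ... | t , rs′ = r * (- d) + t , c * r ∷ rs′

    unreduce-nz : ∀ {fs} (fs∈ : All (InSpan (g ∷ gs)) fs) {rs} → NonZero rs →
                  NonZero (proj₂ (unreduce fs∈ rs))
    unreduce-nz []        {[]}     ()
    unreduce-nz (_ ∷ fs∈) {r ∷ rs} (inj₁ nz) = inj₁ (*-nonZero c≢0 nz)
    unreduce-nz (_ ∷ fs∈) {r ∷ rs} (inj₂ nz) = inj₂ (unreduce-nz fs∈ nz)

    unreduce-dot : ∀ {fs} (fs∈ : All (InSpan (g ∷ gs)) fs) rs x →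
                   proj₁ (unreduce fs∈ rs) * f x + dot (proj₂ (unreduce fs∈ rs)) x ≡ dot rs x
    unreduce-dot []                      []       x = trans (+-identityʳ _) (*-zeroˡ (f x))
    unreduce-dot {h ∷ _} ((d , _) ∷ fs∈) (r ∷ rs) x =
      trans (lemma r d (proj₁ (unreduce fs∈ rs)) c (f x) (h x) (dot (proj₂ (unreduce fs∈ rs)) x))
            (cong (r * (c * h x + (- d) * f x) +_) (unreduce-dot fs∈ rs x))
      where
      lemma : ∀ r d t c f h e → (r * (- d) + t) * f + (c * r * h + e) ≡ r * (c * h + (- d) * f) + (t * f + e)
      lemma = solve-∀

    pivotElimination : ∀ {fs} → All (InSpan (g ∷ gs)) fs → Elimination gs (f ∷ fs)
    pivotElimination fs∈ = record
      { rest     = reduced fs∈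
      ; length≡  = cong suc (length-reduced fs∈)
      ; rest∈    = reduced∈ fs∈
      ; scale    = 1ℤ
      ; scale≢0  = λ ()
      ; lift     = λ rs → proj₁ (unreduce fs∈ rs) ∷ proj₂ (unreduce fs∈ rs)
      ; lift-nz  = λ nz → inj₂ (unreduce-nz fs∈ nz)
      ; lift-dot = λ rs x → trans (unreduce-dot fs∈ rs x) (lemma (dot rs x))
      }
      where
      lemma : ∀ a → a ≡ 1ℤ * a
      lemma = solve-∀

  -- Either no function involves `g`, which can then be dropped, or the first one that does becomes
  -- the pivot; those before it have coefficient 0 and pass unchanged.
  eliminate : ∀ {g gs} fs → All (InSpan (g ∷ gs)) fs → All (InSpan gs) fs ⊎ Elimination gs fs
  eliminate []       []              = inj₁ []
  eliminate {g} {gs} (f ∷ fs) ((c , p) ∷ fs∈) with c ≟ 0ℤ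
  ... | no c≢0   = inj₂ (pivotElimination f c≢0 p fs∈)
  ... | yes refl with inSpan-ext gs (λ x → lemma (f x) (g x)) p | eliminate fs fs∈
    where
    lemma : ∀ a b → a - 0ℤ * b ≡ a
    lemma = solve-∀
  ... | f∈ | inj₁ all  = inj₁ (f∈ ∷ all)
  ... | f∈ | inj₂ elim = inj₂ record
      { rest     = f ∷ rest
      ; length≡  = cong suc length≡
      ; rest∈    = f∈ ∷ rest∈
      ; scale    = scale
      ; scale≢0  = scale≢0
      ; lift     = λ { (r ∷ rs) → scale * r ∷ lift rs }
      ; lift-nz  = λ { {r ∷ rs} (inj₁ nz) → inj₁ (*-nonZero scale≢0 nz)
                     ; {r ∷ rs} (inj₂ nz) → inj₂ (lift-nz nz) }
      ; lift-dot = λ { (r ∷ rs) x → trans (cong (scale * r * f x +_) (lift-dot rs x))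
                                          (lemma scale r (f x) (dot rs x)) }
      }
    where
    open Elimination elim
    lemma : ∀ s r f d → s * r * f + s * d ≡ s * (r * f + d)
    lemma = solve-∀

  -- Each step removes one generator and at most one function, so the strict inequality survives
  -- until no generator is left and some remaining function is identically zero.
  dependent : ∀ gs fs → All (InSpan gs) fs → length gs ℕ.< length fs → Dependent fs
  dependent []       (f ∷ fs) (f≗0 ∷ _) _  = relation (1ℤ ∷ All.universal (λ _ → 0ℤ) fs) (inj₁ λ ())
    λ x → trans (cong₂ _+_ (cong (1ℤ *_) (f≗0 x)) (zeros fs x)) refl
    where
    zeros : ∀ fs x → dot (All.universal (λ _ → 0ℤ) fs) x ≡ 0ℤ
    zeros []       x = refl
    zeros (f ∷ fs) x = trans (+-identityˡ _) (zeros fs x)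
  dependent (g ∷ gs) fs fs∈ lt with eliminate fs fs∈
  ... | inj₁ fs∈′ = dependent gs fs fs∈′ (ℕ.<-trans (ℕ.n<1+n _) lt)
  ... | inj₂ elim =
    let open Elimination elim
        relation rs nz rs≡0 = dependent gs rest rest∈ (s≤s⁻¹ (subst (suc (length gs) ℕ.<_) length≡ lt))
    in relation (lift rs) (lift-nz nz)
         λ x → trans (lift-dot rs x) (trans (cong (scale *_) (rs≡0 x)) (*-zeroʳ scale))

  -- A relation among triangular blocks is read off at the points of its first nonzero block.
  firstBlock : ∀ {P : Set} (block : A → List F) (point : A → P → X) (as : List A) →
    AllPairs (λ a a′ → All (λ f → ∀ p → f (point a p) ≡ 0ℤ) (block a′)) as →
    (rs : Coeffs (concatMap block as)) → NonZero rs → (∀ x → dot rs x ≡ 0ℤ) →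
    Σ A λ a → Σ (Coeffs (block a)) λ rs′ → NonZero rs′ × (∀ p → dot rs′ (point a p) ≡ 0ℤ)
  firstBlock block point []       []         [] ()
  firstBlock block point (a ∷ as) (a# ∷ as#) rs nz rs≡0
    with nonZero? (proj₁ (++⁻ (block a) rs)) | nonZero-++⁻ (block a) rs nz
  ... | yes nz₁ | _ = a , _ , nz₁ , λ p → begin
      dot rs₁ (point a p)                       ≡⟨ +-identityʳ _ ⟨
      dot rs₁ (point a p) + 0ℤ                  ≡⟨ cong (dot rs₁ (point a p) +_) (dot-vanish rs₂ (later as a# p)) ⟨
      dot rs₁ (point a p) + dot rs₂ (point a p) ≡⟨ dot-++ (block a) rs (point a p) ⟨
      dot rs (point a p)                        ≡⟨ rs≡0 _ ⟩
      0ℤ                                        ∎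
    where
    open ≡-Reasoning
    open import Data.List.Relation.Unary.All.Properties using (++⁺)
    rs₁ = proj₁ (++⁻ (block a) rs)
    rs₂ = proj₂ (++⁻ (block a) rs)
    later : ∀ as → All (λ a′ → All (λ f → ∀ p → f (point a p) ≡ 0ℤ) (block a′)) as →
            ∀ p → All (λ f → f (point a p) ≡ 0ℤ) (concatMap block as)
    later []       []         p = []
    later (_ ∷ as) (ps ∷ pss) p = ++⁺ (All.map (λ q → q p) ps) (later as pss p)
  ... | no ¬nz₁ | inj₁ nz₁ = ⊥-elim (¬nz₁ nz₁)
  ... | no ¬nz₁ | inj₂ nz₂ = firstBlock block point as as# (proj₂ (++⁻ (block a) rs)) nz₂ λ x → begin
      dot (proj₂ (++⁻ (block a) rs)) x                                      ≡⟨ +-identityˡ _ ⟨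
      0ℤ + dot (proj₂ (++⁻ (block a) rs)) x                                 ≡⟨ cong (_+ dot (proj₂ (++⁻ (block a) rs)) x) (dot-zero _ ¬nz₁ x) ⟨
      dot (proj₁ (++⁻ (block a) rs)) x + dot (proj₂ (++⁻ (block a) rs)) x   ≡⟨ dot-++ (block a) rs x ⟨
      dot rs x                                                              ≡⟨ rs≡0 x ⟩
      0ℤ                                                                    ∎
    where open ≡-Reasoning

  -- Generators are given by a predicate here, so closure arguments need no list of them until
  -- `span⇒inSpan`.
  data Span (G : F → Set) : F → Set where
    gen  : ∀ {f} → G f → Span G f
    zero : Span G (λ _ → 0ℤ)
    lin  : ∀ a b {f h} → Span G f → Span G h → Span G (λ x → a * f x + b * h x)
    ext  : ∀ {f h} → (∀ x → f x ≡ h x) → Span G f → Span G h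

  span-∑ : ∀ {G} {B : Set} (ys : List B) {f : B → F} → (∀ y → Span G (f y)) → Span G (λ x → ∑ ys (λ y → f y x))
  span-∑ []       p = zero
  span-∑ (y ∷ ys) {f} p = ext (λ x → lemma (f y x) (∑ ys (λ y → f y x))) (lin 1ℤ 1ℤ (p y) (span-∑ ys p))
    where
    lemma : ∀ a b → 1ℤ * a + 1ℤ * b ≡ a + b
    lemma = solve-∀

  span-bind : ∀ {G H : F → Set} → (∀ {f} → G f → Span H f) → ∀ {f} → Span G f → Span H f
  span-bind G⇒ (gen p)       = G⇒ p
  span-bind G⇒ zero          = zero
  span-bind G⇒ (lin a b p q) = lin a b (span-bind G⇒ p) (span-bind G⇒ q)
  span-bind G⇒ (ext f≗h p)   = ext f≗h (span-bind G⇒ p)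

  -- Operators of this shape, a substitution followed by a multiplication, are linear, so generators
  -- suffice; `∂ i` is one of them.
  span-map : ∀ {G H : F → Set} (k : F) (t : X → X) →
             (∀ {f} → G f → Span H (λ x → k x * f (t x))) →
             ∀ {f} → Span G f → Span H (λ x → k x * f (t x))
  span-map k t G⇒ (gen p)     = G⇒ p
  span-map k t G⇒ zero        = ext (λ x → sym (*-zeroʳ (k x))) zero
  span-map k t G⇒ (ext f≗h p) = ext (λ x → cong (k x *_) (f≗h (t x))) (span-map k t G⇒ p)
  span-map k t G⇒ (lin a b {f} {h} p q) =
    ext (λ x → lemma (k x) a b (f (t x)) (h (t x))) (lin a b (span-map k t G⇒ p) (span-map k t G⇒ q))
    where
    lemma : ∀ k a b f h → a * (k * f) + b * (k * h) ≡ k * (a * f + b * h)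
    lemma = solve-∀

  span⇒inSpan : ∀ {G gs} → (∀ {f} → G f → InSpan gs f) → ∀ {f} → Span G f → InSpan gs f
  span⇒inSpan           G⇒ (gen p)       = G⇒ p
  span⇒inSpan {gs = gs} G⇒ zero          = inSpan-0 gs
  span⇒inSpan {gs = gs} G⇒ (lin a b p q) = inSpan-combine gs a b (span⇒inSpan G⇒ p) (span⇒inSpan G⇒ q)
  span⇒inSpan {gs = gs} G⇒ (ext f≗h p)   = inSpan-ext gs f≗h (span⇒inSpan G⇒ p)

-- Coefficients of the powers of a multilinear polynomial.

module Powers where

  open import Data.Bool.Base using (Bool; true; false; if_then_else_)
  open import Data.Fin.Base using (zero; suc)
  open import Data.Integer.Base using (ℤ; +_; -[1+_]; 0ℤ; 1ℤ; _+_; _-_; _*_)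
  open import Data.Integer.Properties using (*-zeroˡ; *-zeroʳ)
  open import Data.Integer.Tactic.RingSolver using (solve-∀)
  open import Data.List.Base using (List; []; _∷_)
  open import Data.Nat.Base using (ℕ; zero; suc)
  open import Data.Vec.Base using (Vec; []; _∷_; lookup; zipWith)
  open import Data.Vec.Properties using (lookup-zipWith)
  open import Defs using (allVecs)
  open import Relation.Binary.PropositionalEquality
  open Sums

  bit : Bool → ℤ
  bit x = if x then 1ℤ else 0ℤ

  exponents : ∀ d → List (Vec Bool d)
  exponents = allVecs (false ∷ true ∷ [])

  infixl 6 _⊖_
  -- Exponents are integers, so subtraction is total and coefficients at negative exponents are
  -- simply zero.
  _⊖_ : ∀ {d} → Vec ℤ d → Vec Bool d → Vec ℤ d
  _⊖_ = zipWith (λ z x → z - bit x)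

  ⊖-comm : ∀ {d} (u : Vec ℤ d) S T → u ⊖ S ⊖ T ≡ u ⊖ T ⊖ S
  ⊖-comm []      []      []      = refl
  ⊖-comm (z ∷ u) (x ∷ S) (y ∷ T) = cong₂ _∷_ (lemma z (bit x) (bit y)) (⊖-comm u S T)
    where
    lemma : ∀ z x y → z - x - y ≡ z - y - x
    lemma = solve-∀

  isZero : ℤ → ℤ
  isZero (+ zero)  = 1ℤ
  isZero (+ suc _) = 0ℤ
  isZero -[1+ _ ]  = 0ℤ

  *-isZero : ∀ z → z * isZero z ≡ 0ℤ
  *-isZero (+ zero)  = refl
  *-isZero (+ suc n) = *-zeroʳ (+ suc n)
  *-isZero -[1+ n ]  = *-zeroʳ -[1+ n ]

  δ : ∀ {d} → Vec ℤ d → ℤ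
  δ []      = 1ℤ
  δ (z ∷ u) = isZero z * δ u

  lookup-*-δ : ∀ {d} (u : Vec ℤ d) i → lookup u i * δ u ≡ 0ℤ
  lookup-*-δ (z ∷ u) zero    = trans (assoc z (isZero z) (δ u)) (trans (cong (_* δ u) (*-isZero z)) (*-zeroˡ (δ u)))
    where
    assoc : ∀ a b c → a * (b * c) ≡ a * b * c
    assoc = solve-∀
  lookup-*-δ (z ∷ u) (suc i) =
    trans (comm (lookup u i) (isZero z) (δ u)) (trans (cong (isZero z *_) (lookup-*-δ u i)) (*-zeroʳ (isZero z)))
    where
    comm : ∀ a b c → a * (b * c) ≡ b * (a * c)
    comm = solve-∀

  -- powerCoeff χ m u is the coefficient of x^u in P^m, where P = Σ_S χ(S) x^S.
  powerCoeff : ∀ {d} → (Vec Bool d → ℤ) → ℕ → Vec ℤ d → ℤ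
  powerCoeff     χ zero    u = δ u
  powerCoeff {d} χ (suc m) u = ∑ (exponents d) λ S → χ S * powerCoeff χ m (u ⊖ S)

  -- The coefficient form of x_i ∂_i P^(m+1) = (m+1) P^m x_i ∂_i P.
  powerCoeff-deriv : ∀ {d} (χ : Vec Bool d → ℤ) m u i →
    lookup u i * powerCoeff χ (suc m) u ≡
    + suc m * ∑ (exponents d) (λ S → χ S * (bit (lookup S i) * powerCoeff χ m (u ⊖ S)))
  powerCoeff-deriv {d} χ m u i = begin
    lookup u i * ∑ Ss (λ S → χ S * w m (u ⊖ S))
      ≡⟨ ∑-*ˡ Ss (lookup u i) _ ⟨
    ∑ Ss (λ S → lookup u i * (χ S * w m (u ⊖ S)))
      -- Since u_i = (u - S)_i + S_i, the derivative falls either on the remaining m factors or on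
      -- the factor split off.
      ≡⟨ ∑-cong Ss split ⟩
    ∑ Ss (λ S → χ S * (lookup (u ⊖ S) i * w m (u ⊖ S)) + χ S * (bit (lookup S i) * w m (u ⊖ S)))
      ≡⟨ ∑-+ Ss _ _ ⟩
    ∑ Ss (λ S → χ S * (lookup (u ⊖ S) i * w m (u ⊖ S))) + V
      ≡⟨ cong (_+ V) (lower m) ⟩
    + m * V + V
      ≡⟨ successor (+ m) V ⟩
    + suc m * V ∎
    where
    open ≡-Reasoning
    w = powerCoeff χ
    Ss = exponents d
    V = ∑ Ss (λ S → χ S * (bit (lookup S i) * w m (u ⊖ S)))
    split : ∀ S → lookup u i * (χ S * w m (u ⊖ S)) ≡
            χ S * (lookup (u ⊖ S) i * w m (u ⊖ S)) + χ S * (bit (lookup S i) * w m (u ⊖ S))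
    split S rewrite lookup-zipWith (λ z x → z - bit x) i u S =
      lemma (lookup u i) (bit (lookup S i)) (χ S) (w m (u ⊖ S))
      where
      lemma : ∀ z s c e → z * (c * e) ≡ c * ((z - s) * e) + c * (s * e)
      lemma = solve-∀
    successor : ∀ m V → m * V + V ≡ (1ℤ + m) * V
    successor = solve-∀
    lower : ∀ m → ∑ Ss (λ S → χ S * (lookup (u ⊖ S) i * w m (u ⊖ S))) ≡
            + m * ∑ Ss (λ S → χ S * (bit (lookup S i) * w m (u ⊖ S)))
    lower zero    = trans (∑-cong Ss λ S → trans (cong (χ S *_) (lookup-*-δ (u ⊖ S) i)) (*-zeroʳ (χ S)))
                          (trans (∑-zero Ss) (sym (*-zeroˡ (∑ Ss (λ S → χ S * (bit (lookup S i) * w zero (u ⊖ S)))))))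
    lower (suc m) = begin
      ∑ Ss (λ S → χ S * (lookup (u ⊖ S) i * w (suc m) (u ⊖ S)))
        ≡⟨ ∑-cong Ss (λ S → trans (cong (χ S *_) (powerCoeff-deriv χ m (u ⊖ S) i)) (swap₁ (χ S) (+ suc m) _)) ⟩
      ∑ Ss (λ S → + suc m * (χ S * ∑ Ss (λ T → χ T * (bit (lookup T i) * w m (u ⊖ S ⊖ T)))))
        ≡⟨ ∑-*ˡ Ss (+ suc m) _ ⟩
      + suc m * ∑ Ss (λ S → χ S * ∑ Ss (λ T → χ T * (bit (lookup T i) * w m (u ⊖ S ⊖ T))))
        ≡⟨ cong (+ suc m *_) (∑-cong Ss λ S → sym (∑-*ˡ Ss (χ S) _)) ⟩
      + suc m * ∑ Ss (λ S → ∑ Ss (λ T → χ S * (χ T * (bit (lookup T i) * w m (u ⊖ S ⊖ T)))))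
        -- After the exchange T belongs to the differentiated factor, and the sum over S restores
        -- one more power of P.
        ≡⟨ cong (+ suc m *_) (∑-swap Ss Ss _) ⟩
      + suc m * ∑ Ss (λ T → ∑ Ss (λ S → χ S * (χ T * (bit (lookup T i) * w m (u ⊖ S ⊖ T)))))
        ≡⟨ cong (+ suc m *_) (∑-cong Ss λ T → trans (∑-cong Ss λ S → reorder T S) (pull T)) ⟩
      + suc m * ∑ Ss (λ T → χ T * (bit (lookup T i) * w (suc m) (u ⊖ T))) ∎
      where
      swap₁ : ∀ a b c → a * (b * c) ≡ b * (a * c)
      swap₁ = solve-∀
      lemma : ∀ a b c d → a * (b * (c * d)) ≡ b * (c * (a * d))
      lemma = solve-∀
      reorder : ∀ T S → χ S * (χ T * (bit (lookup T i) * w m (u ⊖ S ⊖ T))) ≡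
                χ T * (bit (lookup T i) * (χ S * w m (u ⊖ T ⊖ S)))
      reorder T S rewrite ⊖-comm u S T = lemma (χ S) (χ T) (bit (lookup T i)) (w m (u ⊖ T ⊖ S))
      pull : ∀ T → ∑ Ss (λ S → χ T * (bit (lookup T i) * (χ S * w m (u ⊖ T ⊖ S)))) ≡
             χ T * (bit (lookup T i) * w (suc m) (u ⊖ T))
      pull T = trans (∑-*ˡ Ss (χ T) _) (cong (χ T *_) (∑-*ˡ Ss (bit (lookup T i)) _))

-- Shifted powers of P and their derivatives.

-- A pair (n , e) stands for the coefficient extraction at x^(-e); hence ∂_i acts by f(n , e) ↦ e_i f(n , e - 1_i),
-- up to sign.
module Operators {d : ℕ} (χ : Vec Bool d → ℤ) where

  open import Data.Bool.Base using (true; false)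
  open import Data.Fin.Base using (Fin; zero; suc)
  open import Data.Integer.Base using (+_; 0ℤ; 1ℤ; _+_; _-_; _*_; -_; _^_; ∣_∣)
  open import Data.Integer.Properties using (*-identityˡ; *-assoc; +-identityʳ; pos-+; pos-*; ∣i+j∣≤∣i∣+∣j∣)
  open import Data.Integer.Tactic.RingSolver using (solve-∀)
  open import Data.Nat.Base as ℕ using (zero; suc; _≤_; s≤s; z≤n)
  import Data.Nat.Properties as ℕ
  open import Data.Product using (_,_)
  open import Data.Vec.Base using ([]; _∷_; lookup; zipWith; updateAt; replicate; sum)
  open import Data.Vec.Properties using (lookup-zipWith; lookup∘updateAt)
  open import Data.Vec.Relation.Unary.All using (All; []; _∷_)
  open import Relation.Binary.PropositionalEquality
  open Sums
  open Powers
  open LinearAlgebra (ℕ × Vec ℤ d)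

  w : ℕ → Vec ℤ d → ℤ
  w = powerCoeff χ

  position : ∀ {d} → ℕ → Vec ℤ d → Vec ℤ d → Vec ℤ d
  position n = zipWith λ s z → + n + s - z

  increment decrement : ∀ {d} → Fin d → Vec ℤ d → Vec ℤ d
  increment i σ = updateAt σ i (_+ 1ℤ)
  decrement i e = updateAt e i (_- 1ℤ)

  position-⊖ : ∀ {d} n (σ e : Vec ℤ d) S → position n σ e ⊖ S ≡ position n (σ ⊖ S) e
  position-⊖ n []      []      []      = refl
  position-⊖ n (s ∷ σ) (z ∷ e) (x ∷ S) = cong₂ _∷_ (lemma (+ n) s z (bit x)) (position-⊖ n σ e S)
    where
    lemma : ∀ n s z x → n + s - z - x ≡ n + (s - x) - z
    lemma = solve-∀

  position-decrement : ∀ {d} n (σ e : Vec ℤ d) i → position n σ (decrement i e) ≡ position n (increment i σ) e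
  position-decrement n (s ∷ σ) (z ∷ e) zero    = cong (_∷ position n σ e) (lemma (+ n) s z)
    where
    lemma : ∀ n s z → n + s - (z - 1ℤ) ≡ n + (s + 1ℤ) - z
    lemma = solve-∀
  position-decrement n (s ∷ σ) (z ∷ e) (suc i) = cong (+ n + s - z ∷_) (position-decrement n σ e i)

  -- x^(-n-σ) n^c P^(2n+l)
  term : ℕ → ℕ → Vec ℤ d → F
  term c l σ (n , e) = (+ n) ^ c * w (2 ℕ.* n ℕ.+ l) (position n σ e)

  -- This is exactly -∂/∂x_i if `f (n , e)` is read as a residue against x^e, that is, after
  -- division of the Laurent polynomial by x_1 ⋯ x_d. The factor e_i reflects that a derivative has
  -- no residue.
  ∂ : Fin d → F → F
  ∂ i f (n , e) = lookup e i * f (n , decrement i e)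

  -- One factor P = Σ χ(S) x^S is split off, and each monomial x^S is absorbed into `σ`.
  term-suc : ∀ c l σ x → ∑ (exponents d) (λ S → χ S * term c l (σ ⊖ S) x) ≡ term c (suc l) σ x
  term-suc c l σ (n , e) = begin
    ∑ Ss (λ S → χ S * ((+ n) ^ c * w m (position n (σ ⊖ S) e)))
      ≡⟨ ∑-cong Ss (λ S → trans (cong (λ u → χ S * ((+ n) ^ c * w m u)) (sym (position-⊖ n σ e S)))
                                 (swap (χ S) ((+ n) ^ c) _)) ⟩
    ∑ Ss (λ S → (+ n) ^ c * (χ S * w m (position n σ e ⊖ S)))
      ≡⟨ ∑-*ˡ Ss ((+ n) ^ c) _ ⟩
    (+ n) ^ c * w (suc m) (position n σ e)
      ≡⟨ cong (λ m → (+ n) ^ c * w m (position n σ e)) (ℕ.+-suc (2 ℕ.* n) l) ⟨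
    term c (suc l) σ (n , e) ∎
    where
    open ≡-Reasoning
    Ss = exponents d
    m = 2 ℕ.* n ℕ.+ l
    swap : ∀ a b c → a * (b * c) ≡ b * (a * c)
    swap = solve-∀

  -- The monomial contributes n + σ_i + 1, and the power of P contributes 2n + l + 1 where S
  -- contains i. Both are linear in n; sorting by powers of n gives the two coefficients.
  ∂-term : ∀ i c l σ x →
    ∑ (exponents d) (λ S →
      (χ S * (1ℤ - + 2 * bit (lookup S i))) * term (suc c) l (increment i σ ⊖ S) x +
      (χ S * (lookup σ i + 1ℤ - (1ℤ + + l) * bit (lookup S i))) * term c l (increment i σ ⊖ S) x)
    ≡ ∂ i (term c (suc l) σ) x
  ∂-term i c l σ (n , e) = begin
    ∑ Ss (λ S → (χ S * (1ℤ - + 2 * bit (lookup S i))) * (+ n * N * w m (position n (increment i σ ⊖ S) e)) +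
                (χ S * (lookup σ i + 1ℤ - (1ℤ + + l) * bit (lookup S i))) * (N * w m (position n (increment i σ ⊖ S) e)))
      ≡⟨ ∑-cong Ss (λ S → trans (cong (λ v → (χ S * (1ℤ - + 2 * bit (lookup S i))) * (+ n * N * w m v) +
                                   (χ S * (lookup σ i + 1ℤ - (1ℤ + + l) * bit (lookup S i))) * (N * w m v))
                                   (sym (position-⊖ n (increment i σ) e S)))
                                 (regroup (χ S) (bit (lookup S i)) (+ n) N (w m (u ⊖ S)) (lookup σ i) (+ l))) ⟩
    ∑ Ss (λ S → N * (+ n + (lookup σ i + 1ℤ)) * (χ S * w m (u ⊖ S)) +
                (- (N * (1ℤ + (+ 2 * + n + + l)))) * (χ S * (bit (lookup S i) * w m (u ⊖ S))))
      ≡⟨ trans (∑-+ Ss _ _) (cong₂ _+_ (∑-*ˡ Ss (N * (+ n + (lookup σ i + 1ℤ))) _)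
                                        (∑-*ˡ Ss (- (N * (1ℤ + (+ 2 * + n + + l)))) _)) ⟩
    N * (+ n + (lookup σ i + 1ℤ)) * w (suc m) u + (- (N * (1ℤ + (+ 2 * + n + + l)))) * V
      ≡⟨ cong (λ t → N * (+ n + (lookup σ i + 1ℤ)) * w (suc m) u + (- (N * (1ℤ + t))) * V) m≡ ⟨
    N * (+ n + (lookup σ i + 1ℤ)) * w (suc m) u + (- (N * + suc m)) * V
      ≡⟨ factor N (+ n + (lookup σ i + 1ℤ)) (w (suc m) u) (+ suc m) V ⟩
    N * ((+ n + (lookup σ i + 1ℤ)) * w (suc m) u - + suc m * V)
      -- As e_i = n + σ_i + 1 - u_i, the factor e_i reduces to the derivative rule for u_i.
      ≡⟨ cong (λ t → N * ((+ n + (lookup σ i + 1ℤ)) * w (suc m) u - t)) (powerCoeff-deriv χ m u i) ⟨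
    N * ((+ n + (lookup σ i + 1ℤ)) * w (suc m) u - lookup u i * w (suc m) u)
      ≡⟨ cong (λ t → N * ((+ n + (lookup σ i + 1ℤ)) * w (suc m) u - t * w (suc m) u)) lookup-u ⟩
    N * ((+ n + (lookup σ i + 1ℤ)) * w (suc m) u - (+ n + (lookup σ i + 1ℤ) - lookup e i) * w (suc m) u)
      ≡⟨ cancel N (+ n + (lookup σ i + 1ℤ)) (lookup e i) (w (suc m) u) ⟩
    lookup e i * (N * w (suc m) u)
      ≡⟨ cong₂ (λ m u → lookup e i * (N * w m u)) (ℕ.+-suc (2 ℕ.* n) l) (position-decrement n σ e i) ⟨
    ∂ i (term c (suc l) σ) (n , e) ∎
    where
    open ≡-Reasoning
    Ss = exponents d
    N = (+ n) ^ c
    m = 2 ℕ.* n ℕ.+ l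
    u = position n (increment i σ) e
    V = ∑ Ss (λ S → χ S * (bit (lookup S i) * w m (u ⊖ S)))
    m≡ : + m ≡ + 2 * + n + + l
    m≡ = trans (pos-+ (2 ℕ.* n) l) (cong (_+ + l) (pos-* 2 n))
    lookup-u : lookup u i ≡ + n + (lookup σ i + 1ℤ) - lookup e i
    lookup-u = trans (lookup-zipWith (λ s z → + n + s - z) i (increment i σ) e)
                     (cong (λ s → + n + s - lookup e i) (lookup∘updateAt i σ))
    regroup : ∀ χ s n N W σ l →
      (χ * (1ℤ - + 2 * s)) * (n * N * W) + (χ * (σ + 1ℤ - (1ℤ + l) * s)) * (N * W) ≡
      N * (n + (σ + 1ℤ)) * (χ * W) + (- (N * (1ℤ + (+ 2 * n + l)))) * (χ * (s * W))
    regroup = solve-∀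
    factor : ∀ N a W m V → N * a * W + (- (N * m)) * V ≡ N * (a * W - m * V)
    factor = solve-∀
    cancel : ∀ N a e W → N * (a * W - (a - e) * W) ≡ e * (N * W)
    cancel = solve-∀

  -- Multiplying out a factor P, or differentiating, lowers `l` by one and moves each σ_i by at most
  -- one. So the bound on |σ_i| + l persists, and at l = 0 it bounds the box.
  data Term (K E l : ℕ) : F → Set where
    mk : ∀ {c σ} → c ≤ E → All (λ s → ∣ s ∣ ℕ.+ l ≤ K) σ → Term K E l (term c l σ)

  Terms : ℕ → ℕ → ℕ → F → Set
  Terms K E l = Span (Term K E l)

  private
    ∣-bit∣≤1 : ∀ x → ∣ - bit x ∣ ≤ 1
    ∣-bit∣≤1 true  = ℕ.≤-refl
    ∣-bit∣≤1 false = z≤n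

    ∣1-bit∣≤1 : ∀ x → ∣ 1ℤ - bit x ∣ ≤ 1
    ∣1-bit∣≤1 true  = z≤n
    ∣1-bit∣≤1 false = ℕ.≤-refl

    nudge : ∀ {K l} s t → ∣ t ∣ ≤ 1 → ∣ s ∣ ℕ.+ suc l ≤ K → ∣ s + t ∣ ℕ.+ l ≤ K
    nudge {K} {l} s t ∣t∣≤1 p = begin
      ∣ s + t ∣ ℕ.+ l         ≤⟨ ℕ.+-monoˡ-≤ l (∣i+j∣≤∣i∣+∣j∣ s t) ⟩
      ∣ s ∣ ℕ.+ ∣ t ∣ ℕ.+ l   ≤⟨ ℕ.+-monoˡ-≤ l (ℕ.+-monoʳ-≤ ∣ s ∣ ∣t∣≤1) ⟩
      ∣ s ∣ ℕ.+ 1 ℕ.+ l       ≡⟨ ℕ.+-assoc ∣ s ∣ 1 l ⟩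
      ∣ s ∣ ℕ.+ suc l         ≤⟨ p ⟩
      K                       ∎
      where open ℕ.≤-Reasoning

  ⊖-bound : ∀ {d K l} {σ : Vec ℤ d} S → All (λ s → ∣ s ∣ ℕ.+ suc l ≤ K) σ → All (λ s → ∣ s ∣ ℕ.+ l ≤ K) (σ ⊖ S)
  ⊖-bound []      []                   = []
  ⊖-bound (x ∷ S) (_∷_ {x = s} p ps)   = nudge s (- bit x) (∣-bit∣≤1 x) p ∷ ⊖-bound S ps

  increment-⊖-bound : ∀ {d K l} {σ : Vec ℤ d} i S →
    All (λ s → ∣ s ∣ ℕ.+ suc l ≤ K) σ → All (λ s → ∣ s ∣ ℕ.+ l ≤ K) (increment i σ ⊖ S)
  increment-⊖-bound {K = K} {l} zero    (x ∷ S) (_∷_ {x = s} p ps) =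
    -- The increment and the subtraction of S combine to 0 or 1, so this coordinate too moves by at
    -- most one.
    subst (λ z → ∣ z ∣ ℕ.+ l ≤ K) (lemma s (bit x)) (nudge s (1ℤ - bit x) (∣1-bit∣≤1 x) p) ∷ ⊖-bound S ps
    where
    lemma : ∀ s x → s + (1ℤ - x) ≡ s + 1ℤ - x
    lemma = solve-∀
  increment-⊖-bound             (suc i) (x ∷ S) (_∷_ {x = s} p ps) =
    nudge s (- bit x) (∣-bit∣≤1 x) p ∷ increment-⊖-bound i S ps

  private
    smul : ∀ {G : F → Set} a {f} → Span G f → Span G (λ x → a * f x)
    smul a {f} p = ext (λ x → lemma a (f x)) (lin a 0ℤ p p)
      where
      lemma : ∀ a y → a * y + 0ℤ * y ≡ a * y
      lemma = solve-∀

  descend : ∀ {K E l f} → Terms K E (suc l) f → Terms K E l f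
  descend = span-bind λ where
    (mk {c} {σ} c≤E σ≤) → ext (term-suc c _ σ) (span-∑ (exponents d) λ S → smul (χ S) (gen (mk c≤E (⊖-bound S σ≤))))

  descend-+ : ∀ m {K E l f} → Terms K E (m ℕ.+ l) f → Terms K E l f
  descend-+ zero    p = p
  descend-+ (suc m) p = descend-+ m (descend p)

  ∂-terms : ∀ {K E l f} i → Terms K E (suc l) f → Terms K (suc E) l (∂ i f)
  ∂-terms {l = l} i = span-map (λ (n , e) → lookup e i) (λ (n , e) → n , decrement i e) λ where
    (mk {c} {σ} c≤E σ≤) → ext (∂-term i c _ σ) (span-∑ (exponents d) λ S →
      lin (χ S * (1ℤ - + 2 * bit (lookup S i))) (χ S * (lookup σ i + 1ℤ - (1ℤ + + l) * bit (lookup S i)))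
              (gen (mk (s≤s c≤E) (increment-⊖-bound i S σ≤)))
              (gen (mk (ℕ.m≤n⇒m≤1+n c≤E) (increment-⊖-bound i S σ≤))))

  falling : ℤ → ℕ → ℤ
  falling z zero    = 1ℤ
  falling z (suc t) = z * falling (z - 1ℤ) t

  fallings : ∀ {d} → Vec ℤ d → Vec ℕ d → ℤ
  fallings []      []      = 1ℤ
  fallings (z ∷ e) (t ∷ a) = falling z t * fallings e a

  infixl 6 _⊝_
  _⊝_ : ∀ {d} → Vec ℤ d → Vec ℕ d → Vec ℤ d
  _⊝_ = zipWith λ z t → z - + t

  -- The composite of the `∂ i` in closed form; its falling factorials show where it vanishes.
  ∂^ : Vec ℕ d → F → F
  ∂^ a f (n , e) = fallings e a * f (n , e ⊝ a)

  fallings-zero : ∀ {d} (e : Vec ℤ d) → fallings e (replicate d 0) ≡ 1ℤ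
  fallings-zero []      = refl
  fallings-zero (z ∷ e) = trans (*-identityˡ _) (fallings-zero e)

  ⊝-zero : ∀ {d} (e : Vec ℤ d) → e ⊝ replicate d 0 ≡ e
  ⊝-zero []      = refl
  ⊝-zero (z ∷ e) = cong₂ _∷_ (+-identityʳ z) (⊝-zero e)

  fallings-suc : ∀ {d} (e : Vec ℤ d) a i →
                 lookup e i * fallings (decrement i e) a ≡ fallings e (updateAt a i suc)
  fallings-suc (z ∷ e) (t ∷ a) zero    = sym (*-assoc z _ _)
  fallings-suc (z ∷ e) (t ∷ a) (suc i) =
    trans (swap (lookup e i) (falling z t) _) (cong (falling z t *_) (fallings-suc e a i))
    where
    swap : ∀ a b c → a * (b * c) ≡ b * (a * c)
    swap = solve-∀

  ⊝-suc : ∀ {d} (e : Vec ℤ d) a i → decrement i e ⊝ a ≡ e ⊝ updateAt a i suc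
  ⊝-suc (z ∷ e) (t ∷ a) zero    = cong (_∷ e ⊝ a) (lemma z (+ t))
    where
    lemma : ∀ z t → z - 1ℤ - t ≡ z - (1ℤ + t)
    lemma = solve-∀
  ⊝-suc (z ∷ e) (t ∷ a) (suc i) = cong (z - + t ∷_) (⊝-suc e a i)

  -- Builds `a` from zero by unit increments, so that `∂^ a` is an iterate of the `∂ i`, with
  -- induction on the order |a|.
  data OrderView {d} : Vec ℕ d → ℕ → Set where
    zeros : OrderView (replicate d 0) 0
    incr  : ∀ {a s} i → sum a ≡ s → OrderView (updateAt a i suc) (suc s)

  orderView : ∀ {d} (a : Vec ℕ d) → OrderView a (sum a)
  orderView []          = zeros
  orderView (suc t ∷ a) = incr {a = t ∷ a} zero refl
  orderView (zero ∷ a) with sum a in eq | orderView a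
  ... | _ | zeros    = zeros
  ... | _ | incr {a′} i p = incr {a = zero ∷ a′} (suc i) p

  ∂^-terms : ∀ s (a : Vec ℕ d) {K E l f} → sum a ≡ s → Terms K E (s ℕ.+ l) f → Terms K (s ℕ.+ E) l (∂^ a f)
  ∂^-terms s a eq = helper s a (subst (OrderView a) eq (orderView a))
    where
    helper : ∀ s (a : Vec ℕ d) {K E l f} → OrderView a s → Terms K E (s ℕ.+ l) f → Terms K (s ℕ.+ E) l (∂^ a f)
    helper zero    _ {f = f} zeros p = ext (λ (n , e) → sym (begin
        fallings e (replicate d 0) * f (n , e ⊝ replicate d 0)
          ≡⟨ cong₂ (λ c e → c * f (n , e)) (fallings-zero e) (⊝-zero e) ⟩
        1ℤ * f (n , e)
          ≡⟨ *-identityˡ _ ⟩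
        f (n , e) ∎)) p
      where open ≡-Reasoning
    helper (suc s) _ {K} {E} {l} {f} (incr {a} i eq) p = ext (λ (n , e) → begin
        lookup e i * (fallings (decrement i e) a * f (n , decrement i e ⊝ a))
          ≡⟨ *-assoc (lookup e i) _ _ ⟨
        lookup e i * fallings (decrement i e) a * f (n , decrement i e ⊝ a)
          ≡⟨ cong₂ (λ c e → c * f (n , e)) (fallings-suc e a i) (⊝-suc e a i) ⟩
        ∂^ (updateAt a i suc) f (n , e) ∎)
        (∂-terms i (helper s a (subst (OrderView a) eq (orderView a)) (subst (λ l → Terms K E l f) (sym (ℕ.+-suc s l)) p)))
      where open ≡-Reasoning

-- Enumeration of vectors and of boxes of integers.

module Enumeration where

  open import Data.Integer.Base using (+_; -[1+_]; ∣_∣)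
  open import Data.List.Base as List using (List; []; _∷_; _++_; concat; concatMap; length; upTo)
  open import Data.List.Membership.Propositional using (_∈_)
  open import Data.List.Membership.Propositional.Properties using (∈-map⁺; ∈-concat⁺′; ∈-upTo⁺; ∈-++⁺ˡ; ∈-++⁺ʳ)
  open import Data.List.Properties using (length-++; length-map; length-upTo)
  open import Data.List.Relation.Unary.All as All using (All; []; _∷_)
  open import Data.List.Relation.Unary.All.Properties using (map⁺; concat⁺)
  open import Data.Nat.Base using (zero; suc; _+_; _*_; _^_; _≤_; s≤s)
  open import Data.Vec.Base using ([]; _∷_)
  import Data.Vec.Relation.Unary.All as VecAll
  open import Defs using (allVecs)
  open import Relation.Binary.PropositionalEquality

  private variable
    A : Set

  length-concat : ∀ {xss : List (List A)} {m} → All (λ xs → length xs ≡ m) xss → length (concat xss) ≡ length xss * m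
  length-concat                  []       = refl
  length-concat {xss = xs ∷ xss} (p ∷ ps) = trans (length-++ xs) (cong₂ _+_ p (length-concat ps))

  length-concatMap : ∀ {B : Set} {f : A → List B} {m} → (∀ x → length (f x) ≡ m) → ∀ xs →
                     length (concatMap f xs) ≡ length xs * m
  length-concatMap {f = f} p xs = trans (length-concat (map⁺ (All.universal p xs))) (cong (_* _) (length-map f xs))

  length-allVecs : ∀ (xs : List A) n → length (allVecs xs n) ≡ length xs ^ n
  length-allVecs xs zero    = refl
  length-allVecs xs (suc n) =
    length-concatMap (λ x → trans (length-map (x ∷_) (allVecs xs n)) (length-allVecs xs n)) xs

  ∈-allVecs : ∀ {xs : List A} {n} {v : Vec A n} → VecAll.All (_∈ xs) v → v ∈ allVecs xs n
  ∈-allVecs                 VecAll.[]                   = here refl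
    where open import Data.List.Relation.Unary.Any using (here)
  ∈-allVecs {xs = xs} {suc n} (VecAll._∷_ {x = x} p ps) =
    ∈-concat⁺′ (∈-map⁺ (x ∷_) (∈-allVecs ps)) (∈-map⁺ (λ x → List.map (x ∷_) (allVecs xs n)) p)

  all-allVecs : ∀ {P : A → Set} {xs} → All P xs → ∀ n → All (VecAll.All P) (allVecs xs n)
  all-allVecs ps zero    = VecAll.[] ∷ []
  all-allVecs ps (suc n) = concat⁺ (map⁺ (All.map (λ p → map⁺ (All.map (p VecAll.∷_) (all-allVecs ps n))) ps))

  interval : ℕ → List ℤ
  interval K = List.map +_ (upTo (suc K)) ++ List.map -[1+_] (upTo K)

  length-interval : ∀ K → length (interval K) ≡ suc K + K
  length-interval K =
    trans (length-++ (List.map +_ (upTo (suc K))))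
          (cong₂ _+_ (trans (length-map +_ (upTo (suc K))) (length-upTo (suc K)))
                     (trans (length-map -[1+_] (upTo K)) (length-upTo K)))

  ∈-interval : ∀ {K} z → ∣ z ∣ ≤ K → z ∈ interval K
  ∈-interval     (+ n)    n≤K = ∈-++⁺ˡ (∈-map⁺ +_ (∈-upTo⁺ (s≤s n≤K)))
  ∈-interval {K} -[1+ n ] n<K = ∈-++⁺ʳ (List.map +_ (upTo (suc K))) (∈-map⁺ -[1+_] (∈-upTo⁺ n<K))

-- Recurrences with integer polynomial coefficients.

module IntegerRecurrences where

  open import Data.Integer.Base using (+_; 0ℤ; _+_; _*_)
  open import Data.List.Base using (List; []; _∷_)
  open import Data.List.Relation.Unary.Any using (Any)
  open import Data.Nat.Base using (suc)
  open import Function.Base using (_∘_)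
  open import Relation.Binary.PropositionalEquality using (_≢_)

  evalℤ : List ℤ → ℕ → ℤ
  evalℤ []      n = 0ℤ
  evalℤ (r ∷ p) n = r + + n * evalℤ p n

  -- Here `β` is the sequence re-based at the current index, so that shifting it leaves the argument
  -- `n` of the polynomials alone.
  recurrenceSum : List (List ℤ) → (ℕ → ℤ) → ℕ → ℤ
  recurrenceSum []       β n = 0ℤ
  recurrenceSum (p ∷ ps) β n = evalℤ p n * β 0 + recurrenceSum ps (β ∘ suc) n

  NonZeroPolys : List (List ℤ) → Set
  NonZeroPolys = Any (Any (_≢ 0ℤ))

-- A recurrence for the constant term of (P^2 / (x_1 ⋯ x_d))^n.

module ConstantTerms {d : ℕ} (χ : Vec Bool d → ℤ) where

  open import Data.Empty using (⊥-elim)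
  open import Data.Integer.Base using (+_; 0ℤ; 1ℤ; _+_; _-_; _*_; _^_)
  open import Data.Integer.Properties as ℤ using (*-zeroˡ; *-zeroʳ; i*j≡0⇒i≡0∨j≡0)
  open import Data.Integer.Tactic.RingSolver using (solve-∀)
  open import Data.List.Base using (List; []; _∷_; concat; concatMap; map; length; upTo; applyUpTo)
  open import Data.List.Membership.Propositional.Properties using (∈-map⁺; ∈-concat⁺′; ∈-upTo⁺)
  open import Data.List.Properties using (length-map; length-upTo; length-applyUpTo)
  open import Data.List.Relation.Unary.All as All using (All; []; _∷_)
  open import Data.List.Relation.Unary.All.Properties using (map⁺; map⁻; concat⁺; ++⁻; applyUpTo⁺₁; all-upTo)
  open import Data.List.Relation.Unary.AllPairs as AllPairs using (AllPairs; []; _∷_)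
  import Data.List.Relation.Unary.AllPairs.Properties as AllPairs
  open import Data.List.Relation.Unary.Any using (Any; here; there)
  open import Data.Nat.Base as ℕ using (zero; suc; _≤_; _<_; s≤s; z≤n)
  import Data.Nat.Properties as ℕ
  import Data.Nat.Tactic.RingSolver as ℕ
  open import Data.Product using (Σ; _,_; proj₁; proj₂)
  open import Data.Sum.Base using (inj₁; inj₂)
  open import Data.Vec.Base as Vec using ([]; _∷_; replicate; sum)
  import Data.Vec.Relation.Unary.All as VecAll
  open import Defs using (allVecs)
  open import Function.Base using (_∘_)
  open import Relation.Binary.PropositionalEquality
  open Enumeration
  open IntegerRecurrences
  open Powers
  open Operators χ
  open LinearAlgebra (ℕ × Vec ℤ d)

  falling-vanish : ∀ {t t′} → t < t′ → falling (+ t) t′ ≡ 0ℤ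
  falling-vanish {zero}  {suc t′} _          = *-zeroˡ (falling (+ 0 - 1ℤ) t′)
  falling-vanish {suc t} {suc t′} (s≤s t<t′) = trans (cong (+ suc t *_) (falling-vanish t<t′)) (*-zeroʳ (+ suc t))

  falling-self : ∀ t → falling (+ t) t ≢ 0ℤ
  falling-self zero    ()
  falling-self (suc t) = *-nonZero {+ suc t} (λ ()) (falling-self t)

  fallings-self : ∀ {d} (a : Vec ℕ d) → fallings (Vec.map +_ a) a ≢ 0ℤ
  fallings-self []      ()
  fallings-self (t ∷ a) = *-nonZero (falling-self t) (fallings-self a)

  ⊝-self : ∀ {d} (a : Vec ℕ d) → Vec.map +_ a ⊝ a ≡ replicate d 0ℤ
  ⊝-self []      = refl
  ⊝-self (t ∷ a) = cong₂ _∷_ (ℤ.+-inverseʳ (+ t)) (⊝-self a)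

  Vanishes : ∀ {d} → Vec ℕ d → Vec ℕ d → Set
  Vanishes a a′ = fallings (Vec.map +_ a) a′ ≡ 0ℤ

  -- `allVecs` is in lexicographic order: where a later a′ first differs from a it has the larger
  -- entry, so the falling factorial of a_i of length a′_i runs through 0.
  allVecs-vanish : ∀ A d → AllPairs Vanishes (allVecs (upTo A) d)
  allVecs-vanish A zero    = [] ∷ []
  allVecs-vanish A (suc d) = AllPairs.concat⁺
    (map⁺ (All.universal (λ t → AllPairs.map⁺ (AllPairs.map (λ {a} {a′} → tail t a a′) (allVecs-vanish A d))) (upTo A)))
    (AllPairs.map⁺ (AllPairs.applyUpTo⁺₁ _ A λ i<j _ →
      map⁺ (All.universal (λ a → map⁺ (All.universal (λ a′ → head i<j a a′) (allVecs (upTo A) d))) (allVecs (upTo A) d))))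
    where
    tail : ∀ t (a a′ : Vec ℕ d) → Vanishes a a′ → Vanishes (t ∷ a) (t ∷ a′)
    tail t a a′ p = trans (cong (falling (+ t) t *_) p) (*-zeroʳ (falling (+ t) t))
    head : ∀ {t t′} → t < t′ → (a a′ : Vec ℕ d) → Vanishes (t ∷ a) (t′ ∷ a′)
    head t<t′ a a′ = trans (cong (_* fallings (Vec.map +_ a) a′) (falling-vanish t<t′)) (*-zeroˡ (fallings (Vec.map +_ a) a′))

  -- Used with φ = ∂^a, x at e = a and y at e = 0, it strips the derivative from a relation at the
  -- price of a scalar.
  dot-map : ∀ (φ : F → F) {k x y} → (∀ f → φ f x ≡ k * f y) →
            ∀ (fs : List F) (rs : Coeffs (map φ fs)) → dot rs x ≡ k * dot (map⁻ rs) y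
  dot-map φ {k} eq []       []       = sym (*-zeroʳ k)
  dot-map φ {k} {x} {y} eq (f ∷ fs) (r ∷ rs) =
    trans (cong₂ (λ a b → r * a + b) (eq f) (dot-map φ {k} {x} {y} eq fs rs)) (lemma r k (f y) (dot (map⁻ rs) y))
    where
    lemma : ∀ r k f e → r * (k * f) + k * e ≡ k * (r * f + e)
    lemma = solve-∀

  nonZero-map⁻ : ∀ {φ : F → F} fs (rs : Coeffs (map φ fs)) → NonZero rs → NonZero (map⁻ {xs = fs} rs)
  nonZero-map⁻ []       []       ()
  nonZero-map⁻ (f ∷ fs) (r ∷ rs) (inj₁ nz) = inj₁ nz
  nonZero-map⁻ (f ∷ fs) (r ∷ rs) (inj₂ nz) = inj₂ (nonZero-map⁻ fs rs nz)

  -- Counting derivatives against spanning functions.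

  power : ℕ → ℕ → F
  power j c = term c (2 ℕ.* j) (replicate d (+ j))

  powers : ℕ → ℕ → ℕ → List F
  powers D J C = concat (applyUpTo (λ j → applyUpTo (power (D ℕ.+ j)) C) J)

  derivatives : ℕ → ℕ → ℕ → ℕ → List F
  derivatives A D J C = concatMap (λ a → map (∂^ a) (powers D J C)) (allVecs (upTo A) d)

  spanning : ℕ → ℕ → List F
  spanning K E = concatMap (λ c → map (term c 0) (allVecs (interval K) d)) (upTo E)

  length-powers : ∀ D J C → length (powers D J C) ≡ J ℕ.* C
  length-powers D J C = trans
    (length-concat (applyUpTo⁺₁ (λ j → applyUpTo (power (D ℕ.+ j)) C) J λ _ → length-applyUpTo _ C))
    (cong (ℕ._* C) (length-applyUpTo (λ j → applyUpTo (power (D ℕ.+ j)) C) J))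

  length-derivatives : ∀ A D J C → length (derivatives A D J C) ≡ A ℕ.^ d ℕ.* (J ℕ.* C)
  length-derivatives A D J C = trans
    (length-concatMap (λ a → trans (length-map (∂^ a) (powers D J C)) (length-powers D J C)) (allVecs (upTo A) d))
    (cong (ℕ._* (J ℕ.* C)) (trans (length-allVecs (upTo A) d) (cong (ℕ._^ d) (length-upTo A))))

  length-spanning : ∀ K E → length (spanning K E) ≡ E ℕ.* (suc K ℕ.+ K) ℕ.^ d
  length-spanning K E = trans
    (length-concatMap (λ c → trans (length-map (term c 0) (allVecs (interval K) d))
       (trans (length-allVecs (interval K) d) (cong (ℕ._^ d) (length-interval K)))) (upTo E))
    (cong (ℕ._* (suc K ℕ.+ K) ℕ.^ d) (length-upTo E))

  term∈spanning : ∀ {K E E′ f} → E < E′ → Term K E 0 f → InSpan (spanning K E′) f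
  term∈spanning {K} {E′ = E′} E<E′ (mk {c} {σ} c≤E σ≤) =
    inSpan-∈ (∈-concat⁺′ (∈-map⁺ (term c 0) (∈-allVecs (VecAll.map (λ {s} p → ∈-interval s (subst (_≤ K) (ℕ.+-identityʳ _) p)) σ≤)))
                         (∈-map⁺ (λ c → map (term c 0) (allVecs (interval K) d)) (∈-upTo⁺ (ℕ.≤-<-trans c≤E E<E′))))

  sum-≤ : ∀ {d A} {a : Vec ℕ d} → VecAll.All (_< A) a → sum a ≤ d ℕ.* A
  sum-≤ VecAll.[]       = z≤n
  sum-≤ (p VecAll.∷ ps) = ℕ.+-mono-≤ (ℕ.<⇒≤ p) (sum-≤ ps)

  -- Since |a| ≤ D ≤ 2 (D + j), the exponent of P stays at least 2n after differentiation, and the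
  -- `r` surplus factors are multiplied out.
  ∂^-power∈spanning : ∀ {D J C j c} {a : Vec ℕ d} → sum a ≤ D → j < J → c < C →
    InSpan (spanning (3 ℕ.* (D ℕ.+ J)) (D ℕ.+ C)) (∂^ a (power (D ℕ.+ j) c))
  ∂^-power∈spanning {D} {J} {C} {j} {c} {a} a≤D j<J c<C =
    span⇒inSpan (term∈spanning (ℕ.+-mono-≤-< a≤D c<C)) (descend-+ r (∂^-terms (sum a) a refl start))
    where
    l = 2 ℕ.* (D ℕ.+ j)
    r = l ℕ.∸ sum a
    K = 3 ℕ.* (D ℕ.+ J)
    a≤l : sum a ≤ l
    a≤l = ℕ.≤-trans a≤D (ℕ.≤-trans (ℕ.m≤m+n D j) (ℕ.m≤m+n _ _))
    all-replicate : ∀ {P : ℤ → Set} {s} d → P s → VecAll.All P (replicate d s)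
    all-replicate zero    p = VecAll.[]
    all-replicate (suc d) p = p VecAll.∷ all-replicate d p
    l≡ : l ≡ sum a ℕ.+ (r ℕ.+ 0)
    l≡ = sym (trans (cong (sum a ℕ.+_) (ℕ.+-identityʳ r)) (ℕ.m+[n∸m]≡n a≤l))
    start : Terms K c (sum a ℕ.+ (r ℕ.+ 0)) (power (D ℕ.+ j) c)
    -- Initially every σ_i is D + j and l is 2 (D + j); their sum 3 (D + j) explains the 3 in `K`.
    start = subst (λ m → Terms K c m (power (D ℕ.+ j) c)) l≡
      (gen (mk ℕ.≤-refl (all-replicate d (ℕ.*-monoʳ-≤ 3 (ℕ.+-monoʳ-≤ D (ℕ.<⇒≤ j<J))))))

  derivatives∈spanning : ∀ A J C → let D = d ℕ.* A in
    All (InSpan (spanning (3 ℕ.* (D ℕ.+ J)) (D ℕ.+ C))) (derivatives A D J C)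
  derivatives∈spanning A J C = concat⁺ (map⁺ (All.map
    (λ a<A → map⁺ (concat⁺ (applyUpTo⁺₁ _ J λ j<J → applyUpTo⁺₁ _ C λ c<C → ∂^-power∈spanning (sum-≤ a<A) j<J c<C)))
    (all-allVecs (all-upTo A) d)))

  ^-distribʳ-* : ∀ m n o → (m ℕ.* n) ℕ.^ o ≡ m ℕ.^ o ℕ.* n ℕ.^ o
  ^-distribʳ-* m n zero    = refl
  ^-distribʳ-* m n (suc o) = trans (cong (m ℕ.* n ℕ.*_) (^-distribʳ-* m n o)) (lemma m n (m ℕ.^ o) (n ℕ.^ o))
    where
    lemma : ∀ m n p q → m ℕ.* n ℕ.* (p ℕ.* q) ≡ m ℕ.* p ℕ.* (n ℕ.* q)
    lemma = ℕ.solve-∀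

  -- The spanning set has O(q^(d+1)) elements and there are q^d · q · D = d q^(d+2) derivatives; the constant
  -- bounds the side 6(D+q)+1 of the box by (6d+7) q.
  q : ℕ
  q = suc (2 ℕ.* (6 ℕ.* d ℕ.+ 7) ℕ.^ d)

  spanning<derivatives : 0 < d → let D = d ℕ.* q in
    length (spanning (3 ℕ.* (D ℕ.+ q)) (D ℕ.+ D)) < length (derivatives q D q D)
  spanning<derivatives 0<d = begin-strict
    length (spanning K (D ℕ.+ D))               ≡⟨ length-spanning K (D ℕ.+ D) ⟩
    (D ℕ.+ D) ℕ.* (suc K ℕ.+ K) ℕ.^ d           ≤⟨ ℕ.*-monoʳ-≤ (D ℕ.+ D) (ℕ.^-monoˡ-≤ d side) ⟩
    (D ℕ.+ D) ℕ.* (s ℕ.* q) ℕ.^ d               ≡⟨ cong ((D ℕ.+ D) ℕ.*_) (^-distribʳ-* s q d) ⟩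
    (D ℕ.+ D) ℕ.* (s ℕ.^ d ℕ.* q ℕ.^ d)         ≡⟨ regroup D (s ℕ.^ d) (q ℕ.^ d) ⟩
    -- Here `q` is one more than 2 s^d; strictness also needs q^d D to be nonzero, whence `0<d`.
    (q ℕ.^ d ℕ.* D) ℕ.* (2 ℕ.* s ℕ.^ d)         <⟨ ℕ.*-monoʳ-< (q ℕ.^ d ℕ.* D) (ℕ.n<1+n (2 ℕ.* s ℕ.^ d)) ⟩
    (q ℕ.^ d ℕ.* D) ℕ.* q                       ≡⟨ commute (q ℕ.^ d) D q ⟩
    q ℕ.^ d ℕ.* (q ℕ.* D)                       ≡⟨ length-derivatives q D q D ⟨
    length (derivatives q D q D)                ∎
    where
    open ℕ.≤-Reasoning
    D = d ℕ.* q
    K = 3 ℕ.* (D ℕ.+ q)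
    s = 6 ℕ.* d ℕ.+ 7
    instance
      d≢0 : ℕ.NonZero d
      d≢0 = ℕ.>-nonZero 0<d
      D≢0 : ℕ.NonZero D
      D≢0 = ℕ.m*n≢0 d q
      q^d≢0 : ℕ.NonZero (q ℕ.^ d)
      q^d≢0 = ℕ.m^n≢0 q d
      q^dD≢0 : ℕ.NonZero (q ℕ.^ d ℕ.* D)
      q^dD≢0 = ℕ.m*n≢0 (q ℕ.^ d) D
    regroup : ∀ D x y → (D ℕ.+ D) ℕ.* (x ℕ.* y) ≡ y ℕ.* D ℕ.* (2 ℕ.* x)
    regroup = ℕ.solve-∀
    commute : ∀ x D q → x ℕ.* D ℕ.* q ≡ x ℕ.* (q ℕ.* D)
    commute = ℕ.solve-∀
    expand : ∀ d q → 1 ℕ.+ 3 ℕ.* (d ℕ.* q ℕ.+ q) ℕ.+ 3 ℕ.* (d ℕ.* q ℕ.+ q) ≡ 1 ℕ.+ (6 ℕ.* d ℕ.+ 6) ℕ.* q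
    expand = ℕ.solve-∀
    collect : ∀ d q → q ℕ.+ (6 ℕ.* d ℕ.+ 6) ℕ.* q ≡ (6 ℕ.* d ℕ.+ 7) ℕ.* q
    collect = ℕ.solve-∀
    side : suc K ℕ.+ K ≤ s ℕ.* q
    side = begin
      suc K ℕ.+ K                       ≡⟨ expand d q ⟩
      1 ℕ.+ (6 ℕ.* d ℕ.+ 6) ℕ.* q       ≤⟨ ℕ.+-monoˡ-≤ ((6 ℕ.* d ℕ.+ 6) ℕ.* q) (s≤s z≤n) ⟩
      q ℕ.+ (6 ℕ.* d ℕ.+ 6) ℕ.* q       ≡⟨ collect d q ⟩
      s ℕ.* q                           ∎

  -- At e = a, `∂^ a` multiplies the value at e = 0 by a_1! ⋯ a_d!, which is nonzero and cancels.
  powersRelation : ∀ A D J C → Dependent (derivatives A D J C) →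
    Σ (Coeffs (powers D J C)) λ rs → NonZero rs × (∀ n → dot rs (n , replicate d 0ℤ) ≡ 0ℤ)
  powersRelation A D J C (relation rs nz rs≡0)
    with firstBlock {P = ℕ} (λ a → map (∂^ a) (powers D J C)) (λ a n → n , Vec.map +_ a) (allVecs (upTo A) d)
           (AllPairs.map (λ {a} {a′} v → map⁺ (All.universal (vanish a a′ v) (powers D J C))) (allVecs-vanish A d)) rs nz rs≡0
    where
    vanish : ∀ (a a′ : Vec ℕ d) → Vanishes a a′ → ∀ f n → ∂^ a′ f (n , Vec.map +_ a) ≡ 0ℤ
    vanish a a′ v f n = trans (cong (_* f (n , Vec.map +_ a ⊝ a′)) v) (*-zeroˡ (f (n , Vec.map +_ a ⊝ a′)))
  ... | a , rs′ , nz′ , rs′≡0 = map⁻ rs′ , nonZero-map⁻ (powers D J C) rs′ nz′ , vanishes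
    where
    vanishes : ∀ n → dot (map⁻ {xs = powers D J C} rs′) (n , replicate d 0ℤ) ≡ 0ℤ
    vanishes n with i*j≡0⇒i≡0∨j≡0 (fallings (Vec.map +_ a) a) (trans (sym (dot-map (∂^ a) {fallings (Vec.map +_ a) a} {y = n , replicate d 0ℤ}
                      (λ f → cong (λ e → fallings (Vec.map +_ a) a * f (n , e)) (⊝-self a)) (powers D J C) rs′)) (rs′≡0 n))
    ... | inj₁ p = ⊥-elim (fallings-self a p)
    ... | inj₂ p = p

  -- Reading a relation as a recurrence.

  polynomial : {fs : List F} → Coeffs fs → List ℤ
  polynomial = All.reduce (λ r → r)

  polynomial-nonZero : ∀ {fs : List F} (rs : Coeffs fs) → NonZero rs → Any (_≢ 0ℤ) (polynomial rs)
  polynomial-nonZero (r ∷ rs) (inj₁ nz) = here nz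
  polynomial-nonZero (r ∷ rs) (inj₂ nz) = there (polynomial-nonZero rs nz)

  -- Horner's scheme: each step moves one factor n into `y`.
  dot-monomials : ∀ C (h : ℕ → F) {n x y} → (∀ c → h c x ≡ (+ n) ^ c * y) → (rs : Coeffs (applyUpTo h C)) →
                  dot rs x ≡ evalℤ (polynomial rs) n * y
  dot-monomials zero    h {y = y} eq []       = sym (*-zeroˡ y)
  dot-monomials (suc C) h {n} {y = y} eq (r ∷ rs) =
    trans (cong₂ (λ a b → r * a + b) (eq 0) (dot-monomials C (h ∘ suc) (λ c → trans (eq (suc c)) (shift (+ n) ((+ n) ^ c) y)) rs))
          (lemma r (+ n) (evalℤ (polynomial rs) n) y)
    where
    shift : ∀ n N y → n * N * y ≡ N * (n * y)
    shift = solve-∀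
    lemma : ∀ r n e y → r * (1ℤ * y) + e * (n * y) ≡ (r + n * e) * y
    lemma = solve-∀

  polynomials : ∀ J C (h : ℕ → ℕ → F) → Coeffs (concat (applyUpTo (λ j → applyUpTo (h j) C) J)) → List (List ℤ)
  polynomials zero    C h rs = []
  polynomials (suc J) C h rs = polynomial (proj₁ (++⁻ (applyUpTo (h 0) C) rs)) ∷
                               polynomials J C (h ∘ suc) (proj₂ (++⁻ (applyUpTo (h 0) C) rs))

  polynomials-nonZero : ∀ J C h rs → NonZero rs → NonZeroPolys (polynomials J C h rs)
  polynomials-nonZero zero    C h [] ()
  polynomials-nonZero (suc J) C h rs nz with nonZero-++⁻ (applyUpTo (h 0) C) rs nz
  ... | inj₁ nz₁ = here (polynomial-nonZero _ nz₁)
  ... | inj₂ nz₂ = there (polynomials-nonZero J C (h ∘ suc) _ nz₂)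

  dot-polynomials : ∀ J C h {n x} {β : ℕ → ℤ} → (∀ j c → h j c x ≡ (+ n) ^ c * β j) → ∀ rs →
                    dot rs x ≡ recurrenceSum (polynomials J C h rs) β n
  dot-polynomials zero    C h eq [] = refl
  dot-polynomials (suc J) C h {x = x} eq rs = trans (dot-++ (applyUpTo (h 0) C) rs x)
    (cong₂ _+_ (dot-monomials C (h 0) (eq 0) _) (dot-polynomials J C (h ∘ suc) (eq ∘ suc) _))

  constantTerm : ℕ → ℤ
  constantTerm n = w (2 ℕ.* n) (replicate d (+ n))

  -- Shifting the exponents of x and of P together by j and 2j is what makes this the constant term
  -- of index n + j.
  power-zero : ∀ j c n → power j c (n , replicate d 0ℤ) ≡ (+ n) ^ c * constantTerm (n ℕ.+ j)
  power-zero j c n = cong₂ (λ m u → (+ n) ^ c * w m u) (sym (ℕ.*-distribˡ-+ 2 n j)) (position-zero d)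
    where
    position-zero : ∀ d → position n (replicate d (+ j)) (replicate d 0ℤ) ≡ replicate d (+ (n ℕ.+ j))
    position-zero zero    = refl
    position-zero (suc d) = cong₂ _∷_ (ℤ.+-identityʳ (+ (n ℕ.+ j))) (position-zero d)

  D : ℕ
  D = d ℕ.* q

  D>0 : 0 < d → 0 < D
  D>0 0<d = ℕ.≤-trans 0<d (ℕ.m≤m*n d q)

  constantTerm-recurrence : 0 < d → Σ (List (List ℤ)) λ ps → NonZeroPolys ps ×
                            (∀ n → recurrenceSum ps (λ j → constantTerm (n ℕ.+ (D ℕ.+ j))) n ≡ 0ℤ)
  constantTerm-recurrence 0<d = fromRelation q D D
    (powersRelation q D q D (dependent (spanning (3 ℕ.* (D ℕ.+ q)) (D ℕ.+ D)) (derivatives q D q D)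
                                       (derivatives∈spanning q q D) (spanning<derivatives 0<d)))
    where
    fromRelation : ∀ J C D → Σ (Coeffs (powers D J C)) (λ rs → NonZero rs × (∀ n → dot rs (n , replicate d 0ℤ) ≡ 0ℤ)) →
      Σ (List (List ℤ)) λ ps → NonZeroPolys ps × (∀ n → recurrenceSum ps (λ j → constantTerm (n ℕ.+ (D ℕ.+ j))) n ≡ 0ℤ)
    fromRelation J C D (rs , nz , rs≡0) =
      polynomials J C (power ∘ (D ℕ.+_)) rs , polynomials-nonZero J C (power ∘ (D ℕ.+_)) rs nz ,
      λ n → trans (sym (dot-polynomials J C (power ∘ (D ℕ.+_)) (λ j c → power-zero (D ℕ.+ j) c n) rs)) (rs≡0 n)

-- Counting balanced matrices column by column.

module MatrixCounting where

  open import Data.Bool.Base using (Bool; true; false; _∧_; if_then_else_)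
  open import Data.Fin.Base using (zero; suc)
  open import Data.Integer.Base using (ℤ; +_; 0ℤ; 1ℤ; _+_; _-_; _*_)
  open import Data.Integer.Properties using (*-identityˡ; *-zeroˡ; +-identityˡ; +-identityʳ)
  open import Data.Integer.Tactic.RingSolver using (solve-∀)
  open import Data.List.Base as List using (List; []; _∷_; filterᵇ; length)
  open import Data.Nat.Base as ℕ using (ℕ; zero; suc; _≡ᵇ_)
  open import Data.Vec.Base using (Vec; []; _∷_; lookup; zipWith; map; tabulate; replicate)
  open import Data.Vec.Properties using (tabulate-cong)
  open import Defs
  open import Relation.Binary.PropositionalEquality
  open Sums
  open Powers

  length-filter : ∀ {A : Set} (p : A → Bool) xs → + length (filterᵇ p xs) ≡ ∑ xs (λ x → bit (p x))
  length-filter p []       = refl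
  length-filter p (x ∷ xs) with p x
  ... | true  = cong (λ z → 1ℤ + z) (length-filter p xs)
  ... | false = trans (length-filter p xs) (sym (+-identityˡ _))

  bit-∧ : ∀ x y → bit (x ∧ y) ≡ bit x * bit y
  bit-∧ true  y = sym (*-identityˡ (bit y))
  bit-∧ false y = sym (*-zeroˡ (bit y))

  bit-≡ᵇ : ∀ m n → bit (m ≡ᵇ n) ≡ isZero (+ n - + m)
  bit-≡ᵇ zero    zero    = refl
  bit-≡ᵇ zero    (suc n) = refl
  bit-≡ᵇ (suc m) zero    = refl
  bit-≡ᵇ (suc m) (suc n) = trans (bit-≡ᵇ m n) (cong isZero (shift (+ m) (+ n)))
    where
    shift : ∀ m n → n - m ≡ 1ℤ + n - (1ℤ + m)
    shift = solve-∀

  ∑-allVecs-suc : ∀ {A : Set} (xs : List A) n f →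
                  ∑ (allVecs xs (suc n)) f ≡ ∑ xs (λ x → ∑ (allVecs xs n) (λ v → f (x ∷ v)))
  ∑-allVecs-suc xs n f = trans (∑-concatMap (λ x → List.map (x ∷_) (allVecs xs n)) xs f)
                               (∑-cong xs λ x → ∑-map (x ∷_) (allVecs xs n) f)

  -- Matrices are enumerated by rows; exchanging the rest of a row with the rest of the first
  -- column, row after row, regroups them by first column.
  ∑-firstColumn : ∀ {A : Set} (xs : List A) c m (f : Vec (Vec A (suc c)) m → ℤ) →
    ∑ (allVecs (allVecs xs (suc c)) m) f ≡
    ∑ (allVecs xs m) (λ col → ∑ (allVecs (allVecs xs c) m) (λ M → f (zipWith _∷_ col M)))
  ∑-firstColumn xs c zero    f = sym (+-identityʳ _)
  ∑-firstColumn xs c (suc m) f = begin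
    ∑ (allVecs (allVecs xs (suc c)) (suc m)) f
      ≡⟨ trans (∑-allVecs-suc (allVecs xs (suc c)) m f) (∑-allVecs-suc xs c _) ⟩
    ∑ xs (λ x → ∑ (allVecs xs c) (λ r → ∑ (allVecs (allVecs xs (suc c)) m) (λ M → f ((x ∷ r) ∷ M))))
      ≡⟨ ∑-cong xs (λ x → trans (∑-cong (allVecs xs c) λ r → ∑-firstColumn xs c m (λ M → f ((x ∷ r) ∷ M)))
                                (∑-swap (allVecs xs c) (allVecs xs m) _)) ⟩
    ∑ xs (λ x → ∑ (allVecs xs m) (λ col → ∑ (allVecs xs c) (λ r → ∑ (allVecs (allVecs xs c) m) (λ M →
      f ((x ∷ r) ∷ zipWith _∷_ col M)))))
      ≡⟨ trans (∑-allVecs-suc xs m _) (∑-cong xs λ x → ∑-cong (allVecs xs m) λ col → ∑-allVecs-suc (allVecs xs c) m _) ⟨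
    ∑ (allVecs xs (suc m)) (λ col → ∑ (allVecs (allVecs xs c) (suc m)) (λ M → f (zipWith _∷_ col M))) ∎
    where open ≡-Reasoning

  columns : ∀ {m c} → ℕ → Matrix01 m c → Bool
  columns {c = c} k M = allᵇ (tabulate {n = c} (λ j → ones (map (λ row → lookup row j) M) ≡ᵇ k))

  -- The prescribed row sums form an arbitrary integer vector, since removing a column lowers them
  -- unequally and may make them negative.
  rows : ∀ {m c} → Vec ℤ m → Matrix01 m c → ℤ
  rows []      []        = 1ℤ
  rows (z ∷ u) (row ∷ M) = isZero (z - + ones row) * rows u M

  rows-correct : ∀ {m c} r (M : Matrix01 m c) → bit (allᵇ (map (λ row → ones row ≡ᵇ r) M)) ≡ rows (replicate m (+ r)) M
  rows-correct r []        = refl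
  rows-correct r (row ∷ M) = trans (bit-∧ (ones row ≡ᵇ r) _) (cong₂ _*_ (bit-≡ᵇ (ones row) r) (rows-correct r M))

  +-if : ∀ x n → + ((if x then 1 else 0) ℕ.+ n) ≡ bit x + + n
  +-if true  n = refl
  +-if false n = sym (+-identityˡ (+ n))

  rows-firstColumn : ∀ {m c} (u : Vec ℤ m) col (M : Matrix01 m c) → rows u (zipWith _∷_ col M) ≡ rows (u ⊖ col) M
  rows-firstColumn []      []        []        = refl
  rows-firstColumn (z ∷ u) (x ∷ col) (row ∷ M) = cong₂ (λ a b → isZero a * b)
    (trans (cong (z -_) (+-if x (ones row))) (lemma z (bit x) (+ ones row))) (rows-firstColumn u col M)
    where
    lemma : ∀ z x o → z - (x + o) ≡ z - x - o
    lemma = solve-∀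

  columns-firstColumn : ∀ {m c} k col (M : Matrix01 m c) → columns k (zipWith _∷_ col M) ≡ (ones col ≡ᵇ k) ∧ columns k M
  columns-firstColumn {c = c} k col M = cong₂ _∧_ (cong (λ v → ones v ≡ᵇ k) (heads col M))
    (cong allᵇ (tabulate-cong λ j → cong (λ v → ones v ≡ᵇ k) (tails j col M)))
    where
    heads : ∀ {m} col (M : Matrix01 m c) → map (λ row → lookup row zero) (zipWith _∷_ col M) ≡ col
    heads []        []        = refl
    heads (x ∷ col) (row ∷ M) = cong (x ∷_) (heads col M)
    tails : ∀ {m} j col (M : Matrix01 m c) →
            map (λ row → lookup row (suc j)) (zipWith _∷_ col M) ≡ map (λ row → lookup row j) M
    tails j []        []        = refl
    tails j (x ∷ col) (row ∷ M) = cong (lookup row j ∷_) (tails j col M)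

  -- The weight selects the monomials of the elementary symmetric polynomial e_k.
  weight : ∀ {d} → ℕ → Vec Bool d → ℤ
  weight k S = bit (ones S ≡ᵇ k)

  -- A first column S is a monomial of one factor e_k: it contributes its weight and lowers the row
  -- sums by S. With no columns left all row sums must be 0, which is `δ`.
  count-matrices : ∀ k c {m} (u : Vec ℤ m) →
    ∑ (allMatrices m c) (λ M → rows u M * bit (columns k M)) ≡ powerCoeff (weight k) c u
  count-matrices k zero    {m} u = empty u
    where
    empty : ∀ {m} (u : Vec ℤ m) → ∑ (allMatrices m 0) (λ M → rows u M * 1ℤ) ≡ δ u
    empty []      = refl
    empty {suc m} (z ∷ u) = begin
      ∑ (allMatrices (suc m) 0) (λ M → rows (z ∷ u) M * 1ℤ)
        ≡⟨ trans (∑-allVecs-suc ([] ∷ []) m _) (+-identityʳ _) ⟩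
      ∑ (allMatrices m 0) (λ M → isZero (z - 0ℤ) * rows u M * 1ℤ)
        ≡⟨ ∑-cong (allMatrices m 0) (λ M → lemma (isZero (z - 0ℤ)) (rows u M)) ⟩
      ∑ (allMatrices m 0) (λ M → isZero (z - 0ℤ) * (rows u M * 1ℤ))
        ≡⟨ ∑-*ˡ (allMatrices m 0) (isZero (z - 0ℤ)) _ ⟩
      isZero (z - 0ℤ) * ∑ (allMatrices m 0) (λ M → rows u M * 1ℤ)
        ≡⟨ cong₂ (λ z e → isZero z * e) (+-identityʳ z) (empty u) ⟩
      isZero z * δ u ∎
      where
      open ≡-Reasoning
      lemma : ∀ a b → a * b * 1ℤ ≡ a * (b * 1ℤ)
      lemma = solve-∀
  count-matrices k (suc c) {m} u = begin
    ∑ (allMatrices m (suc c)) (λ M → rows u M * bit (columns k M))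
      ≡⟨ ∑-firstColumn (false ∷ true ∷ []) c m _ ⟩
    ∑ (exponents m) (λ S → ∑ (allMatrices m c) (λ M → rows u (zipWith _∷_ S M) * bit (columns k (zipWith _∷_ S M))))
      ≡⟨ ∑-cong (exponents m) (λ S → trans (∑-cong (allMatrices m c) (split S)) (∑-*ˡ (allMatrices m c) (weight k S) _)) ⟩
    ∑ (exponents m) (λ S → weight k S * ∑ (allMatrices m c) (λ M → rows (u ⊖ S) M * bit (columns k M)))
      ≡⟨ ∑-cong (exponents m) (λ S → cong (weight k S *_) (count-matrices k c (u ⊖ S))) ⟩
    powerCoeff (weight k) (suc c) u ∎
    where
    open ≡-Reasoning
    swap : ∀ a b c → a * (b * c) ≡ b * (a * c)
    swap = solve-∀
    split : ∀ S M → rows u (zipWith _∷_ S M) * bit (columns k (zipWith _∷_ S M)) ≡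
            weight k S * (rows (u ⊖ S) M * bit (columns k M))
    split S M = trans (cong₂ _*_ (rows-firstColumn u S M)
                         (trans (cong bit (columns-firstColumn k S M)) (bit-∧ (ones S ≡ᵇ k) (columns k M))))
                      (swap (rows (u ⊖ S) M) (weight k S) (bit (columns k M)))

  b-powerCoeff : ∀ k n → + b k n ≡ powerCoeff (weight k) (2 ℕ.* n) (replicate (2 ℕ.* k) (+ n))
  b-powerCoeff k n = begin
    + b k n
      ≡⟨ length-filter (rowColSumsᵇ n k) (allMatrices (2 ℕ.* k) (2 ℕ.* n)) ⟩
    ∑ (allMatrices (2 ℕ.* k) (2 ℕ.* n)) (λ M → bit (rowColSumsᵇ n k M))
      ≡⟨ ∑-cong (allMatrices (2 ℕ.* k) (2 ℕ.* n)) (λ M →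
           trans (bit-∧ (allᵇ (map (λ row → ones row ≡ᵇ n) M)) (columns k M)) (cong (_* bit (columns k M)) (rows-correct n M))) ⟩
    ∑ (allMatrices (2 ℕ.* k) (2 ℕ.* n)) (λ M → rows (replicate (2 ℕ.* k) (+ n)) M * bit (columns k M))
      ≡⟨ count-matrices k (2 ℕ.* n) (replicate (2 ℕ.* k) (+ n)) ⟩
    powerCoeff (weight k) (2 ℕ.* n) (replicate (2 ℕ.* k) (+ n)) ∎
    where open ≡-Reasoning

-- Rational coefficients and a nonzero leading polynomial.

module RationalRecurrence where

  open import Data.Fin.Base using (Fin; zero; suc; toℕ; fromℕ)
  open import Data.Integer.Base as ℤ using (ℤ; +_; 0ℤ)
  import Data.Integer.Properties as ℤ
  open import Data.Integer.Tactic.RingSolver using (solve-∀)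
  open import Data.List.Base as List using (List; []; _∷_; _++_)
  open import Data.List.Relation.Unary.Any as Any using (Any; here; there)
  open import Data.List.Relation.Unary.Any.Properties using (map⁺; ++⁺ʳ)
  open import Data.Nat.Base as ℕ using (ℕ; zero; suc)
  open import Data.Product using (Σ; _×_; _,_)
  open import Data.Rational.Base using (ℚ; 0ℚ; _+_; _*_; _/_; toℚᵘ)
  open import Data.Rational.Properties using (toℚᵘ-homo-+; toℚᵘ-homo-*; toℚᵘ-cong; toℚᵘ-injective; toℚᵘ-fromℚᵘ)
  open import Data.Rational.Unnormalised.Base as ℚᵘ using (mkℚᵘ; *≡*; _≃_)
  import Data.Rational.Unnormalised.Properties as ℚᵘ
  open import Defs
  open import Function.Base using (_∘_)
  open import Relation.Nullary using (yes; no; ¬_; contradiction)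
  open import Relation.Nullary.Decidable using (¬?)
  open import Relation.Binary.PropositionalEquality

  open IntegerRecurrences

  fromℤ : ℤ → ℚ
  fromℤ i = i / 1

  -- `i / 1` is normalised by a gcd; over unnormalised fractions the homomorphism laws become
  -- integer identities.
  fromℤ-toℚᵘ : ∀ i → toℚᵘ (fromℤ i) ≃ mkℚᵘ i 0
  fromℤ-toℚᵘ i = toℚᵘ-fromℚᵘ (mkℚᵘ i 0)

  fromℤ-+ : ∀ i j → fromℤ (i ℤ.+ j) ≡ fromℤ i + fromℤ j
  fromℤ-+ i j = toℚᵘ-injective (begin
    toℚᵘ (fromℤ (i ℤ.+ j))                ≈⟨ fromℤ-toℚᵘ (i ℤ.+ j) ⟩
    mkℚᵘ (i ℤ.+ j) 0                      ≈⟨ *≡* (+-cross i j) ⟩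
    mkℚᵘ i 0 ℚᵘ.+ mkℚᵘ j 0                ≈⟨ ℚᵘ.+-cong (fromℤ-toℚᵘ i) (fromℤ-toℚᵘ j) ⟨
    toℚᵘ (fromℤ i) ℚᵘ.+ toℚᵘ (fromℤ j)    ≈⟨ toℚᵘ-homo-+ (fromℤ i) (fromℤ j) ⟨
    toℚᵘ (fromℤ i + fromℤ j)              ∎)
    where
    open ℚᵘ.≃-Reasoning
    +-cross : ∀ i j → (i ℤ.+ j) ℤ.* + 1 ≡ (i ℤ.* + 1 ℤ.+ j ℤ.* + 1) ℤ.* + 1
    +-cross = solve-∀

  fromℤ-* : ∀ i j → fromℤ (i ℤ.* j) ≡ fromℤ i * fromℤ j
  fromℤ-* i j = toℚᵘ-injective (begin
    toℚᵘ (fromℤ (i ℤ.* j))                ≈⟨ fromℤ-toℚᵘ (i ℤ.* j) ⟩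
    mkℚᵘ (i ℤ.* j) 0                      ≈⟨ *≡* refl ⟩
    mkℚᵘ i 0 ℚᵘ.* mkℚᵘ j 0                ≈⟨ ℚᵘ.*-cong (fromℤ-toℚᵘ i) (fromℤ-toℚᵘ j) ⟨
    toℚᵘ (fromℤ i) ℚᵘ.* toℚᵘ (fromℤ j)    ≈⟨ toℚᵘ-homo-* (fromℤ i) (fromℤ j) ⟨
    toℚᵘ (fromℤ i * fromℤ j)              ∎)
    where open ℚᵘ.≃-Reasoning

  fromℤ-≢0 : ∀ {i} → i ≢ 0ℤ → fromℤ i ≢ 0ℚ
  fromℤ-≢0 {i} i≢0 eq with ℚᵘ.≃-trans (ℚᵘ.≃-sym (fromℤ-toℚᵘ i)) (toℚᵘ-cong eq)
  ... | *≡* p = i≢0 (trans (sym (ℤ.*-identityʳ i)) p)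

  eval-fromℤ : ∀ p n → eval (List.map fromℤ p) n ≡ fromℤ (evalℤ p n)
  eval-fromℤ []      n = refl
  eval-fromℤ (r ∷ p) n = sym (trans (fromℤ-+ r _) (cong (λ x → fromℤ r + x)
    (trans (fromℤ-* (+ n) (evalℤ p n)) (cong (ℕ→ℚ n *_) (sym (eval-fromℤ p n))))))

  -- Uniform in `β`, so that induction can pass to `β ∘ suc`.
  Realizes : List (List ℤ) → (L : ℕ) → (Fin (suc L) → Poly) → Set
  Realizes ps L p = ∀ (β : ℕ → ℕ) n →
    sumFin L (λ i → eval (p i) n * ℕ→ℚ (β (toℕ i))) ≡ fromℤ (recurrenceSum ps (λ j → + β j) n)

  Realization : List (List ℤ) → Set
  Realization ps = Σ ℕ λ L → Σ (Fin (suc L) → Poly) λ p → NonZeroPoly (p (fromℕ L)) × Realizes ps L p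

  cons : List ℤ → ∀ {L} → (Fin (suc L) → Poly) → Fin (suc (suc L)) → Poly
  cons r p zero    = List.map fromℤ r
  cons r p (suc i) = p i

  term-fromℤ : ∀ p m n → eval (List.map fromℤ p) n * ℕ→ℚ m ≡ fromℤ (evalℤ p n ℤ.* + m)
  term-fromℤ p m n = trans (cong (_* ℕ→ℚ m) (eval-fromℤ p n)) (sym (fromℤ-* (evalℤ p n) (+ m)))

  cons-realizes : ∀ r ps {L} p → Realizes ps L p → Realizes (r ∷ ps) (suc L) (cons r p)
  cons-realizes r ps p h β n = trans (cong₂ _+_ (term-fromℤ r (β 0) n) (h (β ∘ suc) n))
    (sym (fromℤ-+ (evalℤ r n ℤ.* + β 0) (recurrenceSum ps (λ j → + β (suc j)) n)))

  evalℤ-zero : ∀ p n → ¬ Any (_≢ 0ℤ) p → evalℤ p n ≡ 0ℤ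
  evalℤ-zero []      n ¬nz = refl
  evalℤ-zero (r ∷ p) n ¬nz with r ℤ.≟ 0ℤ
  ... | no r≢0   = contradiction (here r≢0) ¬nz
  ... | yes refl = trans (ℤ.+-identityˡ _) (trans (cong (+ n ℤ.*_) (evalℤ-zero p n (¬nz ∘ there))) (ℤ.*-zeroʳ (+ n)))

  recurrenceSum-zero : ∀ ps β n → ¬ NonZeroPolys ps → recurrenceSum ps β n ≡ 0ℤ
  recurrenceSum-zero []       β n ¬nz = refl
  recurrenceSum-zero (p ∷ ps) β n ¬nz
    rewrite evalℤ-zero p n (¬nz ∘ here) | recurrenceSum-zero ps (β ∘ suc) n (¬nz ∘ there) = cong (ℤ._+ 0ℤ) (ℤ.*-zeroˡ (β 0))

  realize : ∀ ps → NonZeroPolys ps → Realization ps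
  realize (r ∷ ps) nz with Any.any? (Any.any? (λ z → ¬? (z ℤ.≟ 0ℤ))) ps | nz
  ... | yes nz′ | _ = let L , p , top , h = realize ps nz′ in suc L , cons r p , top , cons-realizes r ps p h
  ... | no ¬nz′ | there nz′ = contradiction nz′ ¬nz′
  -- `r` is the last nonzero polynomial; the zero polynomials after it contribute nothing and are
  -- cut off.
  ... | no ¬nz′ | here nz₀  = 0 , (λ _ → List.map fromℤ r) , map⁺ (Any.map fromℤ-≢0 nz₀) , λ β n → begin
      eval (List.map fromℤ r) n * ℕ→ℚ (β 0) + 0ℚ
        ≡⟨ cong₂ _+_ (term-fromℤ r (β 0) n) (cong fromℤ (sym (recurrenceSum-zero ps (λ j → + β (suc j)) n ¬nz′))) ⟩
      fromℤ (evalℤ r n ℤ.* + β 0) + fromℤ (recurrenceSum ps (λ j → + β (suc j)) n)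
        ≡⟨ fromℤ-+ (evalℤ r n ℤ.* + β 0) (recurrenceSum ps (λ j → + β (suc j)) n) ⟨
      fromℤ (recurrenceSum (r ∷ ps) (λ j → + β j) n) ∎
    where open ≡-Reasoning

  -- The relation only involves shifts from D on; zero polynomials fill the shifts below D.
  delay : ℕ → List (List ℤ) → List (List ℤ)
  delay D ps = List.replicate D [] ++ ps

  recurrenceSum-delay : ∀ D ps β n → recurrenceSum (delay D ps) β n ≡ recurrenceSum ps (β ∘ (D ℕ.+_)) n
  recurrenceSum-delay zero    ps β n = refl
  recurrenceSum-delay (suc D) ps β n =
    trans (cong (ℤ._+ recurrenceSum (delay D ps) (β ∘ suc) n) (ℤ.*-zeroˡ (β 0)))
          (trans (ℤ.+-identityˡ _) (recurrenceSum-delay D ps (β ∘ suc) n))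

  -- The zero polynomial in front forces L ≥ 1 even if only one polynomial is nonzero.
  realize-delay : ∀ D → 0 ℕ.< D → ∀ ps → NonZeroPolys ps →
    Σ ℕ λ L → L ℕ.≥ 1 × Σ (Fin (suc L) → Poly) λ p → NonZeroPoly (p (fromℕ L)) × Realizes (delay D ps) L p
  realize-delay (suc D) _ ps nz =
    let L , p , top , h = realize (delay D ps) (++⁺ʳ (List.replicate D []) nz)
    in suc L , ℕ.s≤s ℕ.z≤n , cons [] p , top , cons-realizes [] (delay D ps) p h

  recurrenceSum-cong : ∀ ps {β γ} n → (∀ j → β j ≡ γ j) → recurrenceSum ps β n ≡ recurrenceSum ps γ n
  recurrenceSum-cong []       n β≗γ = refl
  recurrenceSum-cong (p ∷ ps) n β≗γ =
    cong₂ ℤ._+_ (cong (evalℤ p n ℤ.*_) (β≗γ 0)) (recurrenceSum-cong ps n (β≗γ ∘ suc))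

open RationalRecurrence using (fromℤ; realize-delay; recurrenceSum-cong; recurrenceSum-delay)
open MatrixCounting using (weight; b-powerCoeff)
open import Defs
open import Data.Nat using (ℕ; suc; _+_; _≥_)
open import Data.Fin using (Fin; toℕ; fromℕ)
open import Data.Rational using (0ℚ; _*_)
open import Data.Product using (Σ; _×_; _,_)
open import Relation.Binary.PropositionalEquality using (_≡_; cong; sym; trans)
import Data.Nat.Properties as ℕ

theorem1 : (k : ℕ) → k ≥ 1 →
    Σ ℕ (λ L → L ≥ 1 × Σ (Fin (suc L) → Poly) (λ p →
    NonZeroPoly (p (fromℕ L)) ×
    ((n : ℕ) → n ≥ 1 →
    sumFin L (λ i → eval (p i) n * ℕ→ℚ (b k (n + toℕ i))) ≡ 0ℚ)))
theorem1 k k≥1 =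
  let 0<2k = ℕ.≤-trans k≥1 (ℕ.m≤m+n k _)
      ps , nz , ps≡0 = constantTerm-recurrence 0<2k
      L , L≥1 , p , top , h = realize-delay D (D>0 0<2k) ps nz
  -- The sequence j ↦ b_k(n + j) depends on n, which the uniformity of `Realizes` permits.
  in L , L≥1 , p , top , λ n _ → trans (h (λ j → b k (n + j)) n) (cong fromℤ
       (trans (recurrenceSum-delay D ps _ n)
              (trans (recurrenceSum-cong ps n λ j → b-powerCoeff k (n + (D + j))) (ps≡0 n))))
  where
  open ConstantTerms (weight {2 Data.Nat.* k} k)
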